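{- Fix an integer $a\ge 2$ and a constant $g>0$. Then there exist a constant $c>0$ and an integer $n_0$ such that for every integer $n\ge n_0$ the following holds. Every $g$-approximate formulation in the natural encoding for metric capacitated facility location with $n^2$ facilities, $an^4$ clients of unit demand and uniform facility capacity $U=n^3$ (that is, every system of linear inequalities $A(y,x)\le b$ in the variables $(y,x)\in\mathbb{R}^{n^2+an^6}$ that is such a formulation) has at least $2^{c\,n\log n}$ constraints. In other words, every approximate formulation for metric capacitated facility location that uses the natural encoding and has integrality gap at most a constant $g$ has $2^{\Omega(n\log n)}$ constraints.
   Context: Metric capacitated facility location (CFL), natural encoding. Let $F$ be the set of facilities, with $|F|=n^2$, and $C$ the set of clients, with $|C|=an^4$; each client has demand $1$ and each facility has capacity $U=n^3$. The variables are $y_i$ ($i\in F$; facility opening) and $x_{ij}$ ($i\in F$, $j\in C$; assignment of client $j$ to facility $i$), so the dimension is $d=n^2+an^6$. The set $P_0$ of feasible integer solutions consists of all $(y,x)\in\{0,1\}^d$ such that every client is assigned to exactly one facility ($\sum_{i\in F}x_{ij}=1$ for all $j\in C$), clients are assigned only to open facilities ($x_{ij}\le y_i$ for all $i,j$), and capacities are respected ($\sum_{j\in C}x_{ij}\le U$ for all $i\in F$). Let $P=\operatorname{conv}(P_0)$. The set $O_d$ of admissible objective functions consists of all pairs $w=(\mathbf f,\mathbf c)$ with opening costs $\mathbf f\in\mathbb{R}_{+}^{F}$ and connection costs $\mathbf c=[c_{ij}]\in\mathbb{R}_{+}^{F\times C}$ satisfying $c_{ij}\le c_{i'j}+c_{i'j'}+c_{ij'}$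 for all $i,i'\in F$, $j,j'\in C$. The cost of $(y,x)$ is $w^T(y,x)=\sum_i f_iy_i+\sum_{i,j}c_{ij}x_{ij}$. A system of linear inequalities $Az\le b$ with $z=(y,x)\in\mathbb{R}^d$ (only these variables, no additional ones) is a $g$-approximate formulation that uses the natural encoding (equivalently, an approximate formulation with integrality gap at most $g$) if $$\min\{w^Tz\mid Az\le b\}\le\min\{w^Tz\mid z\in P\}\quad\text{for all } w\in\mathbb{R}^d,$$ $$\min\{w^Tz\mid Az\le b\}\ge g^{ -1}\min\{w^Tz\mid z\in P\}\quad\text{for all } w\in O_d.$$ The number of constraints is the number of inequalities in $Az\le b$. -}

module Defs where

open import Data.Nat as ℕ using (ℕ; zero; suc; _^_; ⌊_/2⌋; s≤s; z≤n)
import Data.Nat.Properties as ℕP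
open import Data.Nat.Induction using (<-wellFounded)
open import Data.Nat.Logarithm using (⌊log₂_⌋)
open import Data.Nat.Logarithm.Core using (⌊log2⌋)
open import Data.Integer as ℤ using (+_; -[1+_])
import Data.Integer.Properties as ℤP
open import Data.Rational as ℚ using (ℚ; 0ℚ; 1ℚ; mkℚ; ↥_; ↧ₙ_; toℚᵘ; fromℚᵘ)
import Data.Rational.Properties as ℚP
open import Data.Rational.Solver using (module +-*-Solver)
open import Data.Rational.Unnormalised as ℚᵘ using (ℚᵘ; mkℚᵘ)
import Data.Rational.Unnormalised.Properties as ℚᵘP
open import Data.Fin using (Fin; toℕ)
open import Data.Product using (Σ-syntax; ∃-syntax; _×_; _,_; proj₁; proj₂)
open import Data.Sum using (inj₁; inj₂)
open import Data.Vec.Functional using (foldr)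
open import Algebra.Properties.CommutativeMonoid.Sum ℕP.+-0-commutativeMonoid using (sum)
open import Induction.WellFounded using (Acc; acc)
open import Relation.Binary.PropositionalEquality hiding (J)

-- Reals are Cauchy sequences of rationals carrying a modulus of convergence.
-- They form a setoid under _≈ᵣ_; propositional equality is never used on them.

CauchyProp : (ℕ → ℚ) → Set
CauchyProp x = ∀ ε → 0ℚ ℚ.< ε →
  Σ[ N ∈ ℕ ] (∀ i j → N ℕ.≤ i → N ℕ.≤ j → ℚ.∣ x i ℚ.- x j ∣ ℚ.≤ ε)

record ℝ : Set where
  constructor mkℝ
  field
    seq    : ℕ → ℚ
    cauchy : CauchyProp seq

open ℝ public

infix  4 _≤ᵣ_ _<ᵣ_ _≈ᵣ_
infixl 6 _+ᵣ_
infixl 7 _*ᵣ_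

_≤ᵣ_ : ℝ → ℝ → Set
x ≤ᵣ y = ∀ ε → 0ℚ ℚ.< ε →
  Σ[ N ∈ ℕ ] (∀ i → N ℕ.≤ i → seq x i ℚ.≤ seq y i ℚ.+ ε)

_<ᵣ_ : ℝ → ℝ → Set
x <ᵣ y = Σ[ ε ∈ ℚ ] 0ℚ ℚ.< ε ×
  Σ[ N ∈ ℕ ] (∀ i → N ℕ.≤ i → seq x i ℚ.+ ε ℚ.≤ seq y i)

_≈ᵣ_ : ℝ → ℝ → Set
x ≈ᵣ y = (x ≤ᵣ y) × (y ≤ᵣ x)

abstract
  const-cauchy : ∀ q → CauchyProp (λ _ → q)
  const-cauchy q ε 0<ε = 0 , λ _ _ _ _ →
    subst (ℚ._≤ ε) (sym (cong ℚ.∣_∣ (ℚP.+-inverseʳ q))) (ℚP.<⇒≤ 0<ε)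

fromℚ : ℚ → ℝ
fromℚ q = mkℝ (λ _ → q) (const-cauchy q)

fromℕ : ℕ → ℝ
fromℕ k = fromℚ (+ k ℚ./ 1)

0ᵣ 1ᵣ : ℝ
0ᵣ = fromℚ 0ℚ
1ᵣ = fromℚ 1ℚ

half : ∀ ε → 0ℚ ℚ.< ε → Σ[ δ ∈ ℚ ] 0ℚ ℚ.< δ × δ ℚ.+ δ ≡ ε
half ε 0<ε = ℚ.½ ℚ.* ε
  , subst (ℚ._< ℚ.½ ℚ.* ε) (ℚP.*-zeroʳ ℚ.½) (ℚP.*-monoʳ-<-pos ℚ.½ 0<ε)
  , trans (sym (ℚP.*-distribʳ-+ ε ℚ.½ ℚ.½)) (ℚP.*-identityˡ ε)

abstract
  +-cauchy : (x y : ℝ) → CauchyProp (λ i → seq x i ℚ.+ seq y i)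
  +-cauchy x y ε 0<ε with half ε 0<ε
  ... | δ , 0<δ , refl with cauchy x δ 0<δ | cauchy y δ 0<δ
  ... | N , p | M , q = N ℕ.⊔ M , λ i j hi hj → let open ℚP.≤-Reasoning in begin
      ℚ.∣ (seq x i ℚ.+ seq y i) ℚ.- (seq x j ℚ.+ seq y j) ∣
        ≡⟨ cong ℚ.∣_∣ (regroup (seq x i) (seq y i) (seq x j) (seq y j)) ⟩
      ℚ.∣ (seq x i ℚ.- seq x j) ℚ.+ (seq y i ℚ.- seq y j) ∣
        ≤⟨ ℚP.∣p+q∣≤∣p∣+∣q∣ (seq x i ℚ.- seq x j) (seq y i ℚ.- seq y j) ⟩
      ℚ.∣ seq x i ℚ.- seq x j ∣ ℚ.+ ℚ.∣ seq y i ℚ.- seq y j ∣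
        ≤⟨ ℚP.+-mono-≤
             (p i j (ℕP.m⊔n≤o⇒m≤o N M hi) (ℕP.m⊔n≤o⇒m≤o N M hj))
             (q i j (ℕP.m⊔n≤o⇒n≤o N M hi) (ℕP.m⊔n≤o⇒n≤o N M hj)) ⟩
      δ ℚ.+ δ ∎
    where
    regroup : ∀ a b c d → (a ℚ.+ b) ℚ.- (c ℚ.+ d) ≡ (a ℚ.- c) ℚ.+ (b ℚ.- d)
    regroup = solve 4 (λ a b c d →
      (a :+ b) :- (c :+ d) := (a :- c) :+ (b :- d)) refl
      where open +-*-Solver

_+ᵣ_ : ℝ → ℝ → ℝ
x +ᵣ y = mkℝ (λ i → seq x i ℚ.+ seq y i) (+-cauchy x y)

0<1 : 0ℚ ℚ.< 1ℚ
0<1 = ℚP.positive⁻¹ 1ℚ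

eventually-bounded : (x : ℝ) → Σ[ B ∈ ℚ ] 0ℚ ℚ.< B ×
  Σ[ N ∈ ℕ ] (∀ i → N ℕ.≤ i → ℚ.∣ seq x i ∣ ℚ.≤ B)
eventually-bounded x with cauchy x 1ℚ 0<1
... | N , p = 1ℚ ℚ.+ ℚ.∣ seq x N ∣
  , ℚP.+-mono-<-≤ 0<1 (ℚP.0≤∣p∣ (seq x N))
  , N , λ i hi → let open ℚP.≤-Reasoning in begin
      ℚ.∣ seq x i ∣
        ≡⟨ cong ℚ.∣_∣ (split (seq x i) (seq x N)) ⟩
      ℚ.∣ (seq x i ℚ.- seq x N) ℚ.+ seq x N ∣
        ≤⟨ ℚP.∣p+q∣≤∣p∣+∣q∣ (seq x i ℚ.- seq x N) (seq x N) ⟩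
      ℚ.∣ seq x i ℚ.- seq x N ∣ ℚ.+ ℚ.∣ seq x N ∣
        ≤⟨ ℚP.+-monoˡ-≤ ℚ.∣ seq x N ∣ (p i N hi ℕP.≤-refl) ⟩
      1ℚ ℚ.+ ℚ.∣ seq x N ∣ ∎
  where
  split : ∀ a b → a ≡ (a ℚ.- b) ℚ.+ b
  split = solve 2 (λ a b → a := (a :- b) :+ b) refl
    where open +-*-Solver

divide : ∀ ε K → 0ℚ ℚ.< ε → 0ℚ ℚ.< K → Σ[ δ ∈ ℚ ] 0ℚ ℚ.< δ × K ℚ.* δ ≡ ε
divide ε K 0<ε 0<K = δ , 0<δ , eq
  where
  instance
    K⁺ : ℚ.Positive K
    K⁺ = ℚ.positive 0<K
    K≢0 : ℚ.NonZero K
    K≢0 = ℚP.pos⇒nonZero K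
    1/K⁺ : ℚ.Positive (ℚ.1/ K)
    1/K⁺ = ℚP.1/pos⇒pos K
  δ = ℚ.1/ K ℚ.* ε
  0<δ : 0ℚ ℚ.< δ
  0<δ = subst (ℚ._< δ) (ℚP.*-zeroʳ (ℚ.1/ K)) (ℚP.*-monoʳ-<-pos (ℚ.1/ K) 0<ε)
  eq : K ℚ.* δ ≡ ε
  eq = trans (sym (ℚP.*-assoc K (ℚ.1/ K) ε))
        (trans (cong (ℚ._* ε) (ℚP.*-inverseʳ K)) (ℚP.*-identityˡ ε))

*-mono-≤⁺ : ∀ {a b c d} → 0ℚ ℚ.≤ a → 0ℚ ℚ.≤ d → a ℚ.≤ b → c ℚ.≤ d → a ℚ.* c ℚ.≤ b ℚ.* d
*-mono-≤⁺ {a} {b} {c} {d} 0≤a 0≤d a≤b c≤d = ℚP.≤-trans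
  (ℚP.*-monoˡ-≤-nonNeg a {{ℚ.nonNegative 0≤a}} c≤d)
  (ℚP.*-monoʳ-≤-nonNeg d {{ℚ.nonNegative 0≤d}} a≤b)

*-estimate : ∀ xi yi xj yj B C δ → 0ℚ ℚ.≤ δ →
  ℚ.∣ xi ∣ ℚ.≤ B → ℚ.∣ yj ∣ ℚ.≤ C →
  ℚ.∣ xi ℚ.- xj ∣ ℚ.≤ δ → ℚ.∣ yi ℚ.- yj ∣ ℚ.≤ δ →
  ℚ.∣ xi ℚ.* yi ℚ.- xj ℚ.* yj ∣ ℚ.≤ (B ℚ.+ C) ℚ.* δ
*-estimate xi yi xj yj B C δ 0≤δ bx by p q = begin
  ℚ.∣ xi ℚ.* yi ℚ.- xj ℚ.* yj ∣
    ≡⟨ cong ℚ.∣_∣ (regroup xi yi xj yj) ⟩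
  ℚ.∣ xi ℚ.* (yi ℚ.- yj) ℚ.+ yj ℚ.* (xi ℚ.- xj) ∣
    ≤⟨ ℚP.∣p+q∣≤∣p∣+∣q∣ (xi ℚ.* (yi ℚ.- yj)) (yj ℚ.* (xi ℚ.- xj)) ⟩
  ℚ.∣ xi ℚ.* (yi ℚ.- yj) ∣ ℚ.+ ℚ.∣ yj ℚ.* (xi ℚ.- xj) ∣
    ≡⟨ cong₂ ℚ._+_ (ℚP.∣p*q∣≡∣p∣*∣q∣ xi (yi ℚ.- yj)) (ℚP.∣p*q∣≡∣p∣*∣q∣ yj (xi ℚ.- xj)) ⟩
  ℚ.∣ xi ∣ ℚ.* ℚ.∣ yi ℚ.- yj ∣ ℚ.+ ℚ.∣ yj ∣ ℚ.* ℚ.∣ xi ℚ.- xj ∣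
    ≤⟨ ℚP.+-mono-≤ (*-mono-≤⁺ (ℚP.0≤∣p∣ xi) 0≤δ bx q) (*-mono-≤⁺ (ℚP.0≤∣p∣ yj) 0≤δ by p) ⟩
  B ℚ.* δ ℚ.+ C ℚ.* δ
    ≡⟨ ℚP.*-distribʳ-+ δ B C ⟨
  (B ℚ.+ C) ℚ.* δ ∎
  where
  open ℚP.≤-Reasoning
  regroup : ∀ a b c d → a ℚ.* b ℚ.- c ℚ.* d ≡ a ℚ.* (b ℚ.- d) ℚ.+ d ℚ.* (a ℚ.- c)
  regroup = solve 4 (λ a b c d →
    a :* b :- c :* d := a :* (b :- d) :+ d :* (a :- c)) refl
    where open +-*-Solver

abstract
  *-cauchy : (x y : ℝ) → CauchyProp (λ i → seq x i ℚ.* seq y i)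
  *-cauchy x y ε 0<ε =
    let B , 0<B , Nx , bx = eventually-bounded x
        C , 0<C , Ny , by = eventually-bounded y
        δ , 0<δ , eq = divide ε (B ℚ.+ C) 0<ε (ℚP.+-mono-< 0<B 0<C)
        Mx , p = cauchy x δ 0<δ
        My , q = cauchy y δ 0<δ
        L : ∀ {i} → (Nx ℕ.⊔ Ny) ℕ.⊔ (Mx ℕ.⊔ My) ℕ.≤ i → Nx ℕ.⊔ Ny ℕ.≤ i
        L = ℕP.m⊔n≤o⇒m≤o (Nx ℕ.⊔ Ny) (Mx ℕ.⊔ My)
        R : ∀ {i} → (Nx ℕ.⊔ Ny) ℕ.⊔ (Mx ℕ.⊔ My) ℕ.≤ i → Mx ℕ.⊔ My ℕ.≤ i
        R = ℕP.m⊔n≤o⇒n≤o (Nx ℕ.⊔ Ny) (Mx ℕ.⊔ My)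
    in (Nx ℕ.⊔ Ny) ℕ.⊔ (Mx ℕ.⊔ My) , λ i j hi hj →
      ℚP.≤-trans
        (*-estimate (seq x i) (seq y i) (seq x j) (seq y j) B C δ (ℚP.<⇒≤ 0<δ)
          (bx i (ℕP.m⊔n≤o⇒m≤o Nx Ny (L hi)))
          (by j (ℕP.m⊔n≤o⇒n≤o Nx Ny (L hj)))
          (p i j (ℕP.m⊔n≤o⇒m≤o Mx My (R hi)) (ℕP.m⊔n≤o⇒m≤o Mx My (R hj)))
          (q i j (ℕP.m⊔n≤o⇒n≤o Mx My (R hi)) (ℕP.m⊔n≤o⇒n≤o Mx My (R hj))))
        (ℚP.≤-reflexive eq)

_*ᵣ_ : ℝ → ℝ → ℝ
x *ᵣ y = mkℝ (λ i → seq x i ℚ.* seq y i) (*-cauchy x y)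

∑ : ∀ {k} → (Fin k → ℝ) → ℝ
∑ = foldr _+ᵣ_ 0ᵣ

⌊log₂⌋-bounds-acc : ∀ n (rs : Acc ℕ._<_ n) .{{_ : ℕ.NonZero n}} →
  2 ^ ⌊log2⌋ n rs ℕ.≤ n × n ℕ.< 2 ^ suc (⌊log2⌋ n rs)
⌊log₂⌋-bounds-acc 1 _ = s≤s z≤n , s≤s (s≤s z≤n)
⌊log₂⌋-bounds-acc (suc (suc n)) (acc rs)
  with ⌊log₂⌋-bounds-acc (suc ⌊ n /2⌋) (rs (ℕP.⌊n/2⌋<n (suc n)))
... | lo , hi =
    ℕP.≤-trans (ℕP.*-monoʳ-≤ 2 lo) (twice⌊⌋ (suc (suc n)))
  , ℕP.<-≤-trans (⌊⌋twice (suc (suc n))) (ℕP.*-monoʳ-≤ 2 hi)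
  where
  twice⌊⌋ : ∀ k → 2 ℕ.* ⌊ k /2⌋ ℕ.≤ k
  twice⌊⌋ zero = z≤n
  twice⌊⌋ (suc zero) = z≤n
  twice⌊⌋ (suc (suc k)) = subst (ℕ._≤ suc (suc k))
    (sym (ℕP.*-distribˡ-+ 2 1 ⌊ k /2⌋)) (s≤s (s≤s (twice⌊⌋ k)))
  ⌊⌋twice : ∀ k → k ℕ.< 2 ℕ.* suc ⌊ k /2⌋
  ⌊⌋twice zero = s≤s z≤n
  ⌊⌋twice (suc zero) = s≤s (s≤s z≤n)
  ⌊⌋twice (suc (suc k)) = subst (suc (suc k) ℕ.<_)
    (sym (ℕP.*-distribˡ-+ 2 1 (suc ⌊ k /2⌋))) (s≤s (s≤s (⌊⌋twice k)))

⌊log₂⌋-bounds : ∀ n .{{_ : ℕ.NonZero n}} →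
  2 ^ ⌊log₂ n ⌋ ℕ.≤ n × n ℕ.< 2 ^ suc ⌊log₂ n ⌋
⌊log₂⌋-bounds n = ⌊log₂⌋-bounds-acc n (<-wellFounded n)

exponent-≤ : ∀ n J K A B → 2 ^ A ℕ.≤ n ^ J → n ^ K ℕ.< 2 ^ B → .{{_ : ℕ.NonZero J}} →
  A ℕ.* K ℕ.≤ B ℕ.* J
exponent-≤ n J K A B lo hi = ℕP.<⇒≤ (ℕP.≰⇒> λ le → ℕP.<-irrefl refl (begin-strict
    n ^ (K ℕ.* J)   ≡⟨ ℕP.^-*-assoc n K J ⟨
    (n ^ K) ^ J     <⟨ ℕP.^-monoˡ-< J hi ⟩
    (2 ^ B) ^ J     ≡⟨ ℕP.^-*-assoc 2 B J ⟩
    2 ^ (B ℕ.* J)   ≤⟨ ℕP.^-monoʳ-≤ 2 le ⟩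
    2 ^ (A ℕ.* K)   ≡⟨ ℕP.^-*-assoc 2 A K ⟨
    (2 ^ A) ^ K     ≤⟨ ℕP.^-monoˡ-≤ K lo ⟩
    (n ^ J) ^ K     ≡⟨ ℕP.^-*-assoc n J K ⟩
    n ^ (J ℕ.* K)   ≡⟨ cong (n ^_) (ℕP.*-comm J K) ⟩
    n ^ (K ℕ.* J)   ∎))
  where open ℕP.≤-Reasoning

fraction-≤ : ∀ A B j k → A ℕ.* suc k ℕ.≤ suc B ℕ.* suc j →
  + A ℚ./ suc j ℚ.≤ + B ℚ./ suc k ℚ.+ + 1 ℚ./ suc k
fraction-≤ A B j k h = ℚP.toℚᵘ-cancel-≤ (begin
    toℚᵘ (fromℚᵘ u)                         ≃⟨ ℚP.toℚᵘ-fromℚᵘ u ⟩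
    u                                       ≤⟨ ℚᵘ.*≤* ineq ⟩
    v ℚᵘ.+ w                                ≃⟨ ℚᵘP.+-cong (ℚP.toℚᵘ-fromℚᵘ v) (ℚP.toℚᵘ-fromℚᵘ w) ⟨
    toℚᵘ (fromℚᵘ v) ℚᵘ.+ toℚᵘ (fromℚᵘ w)    ≃⟨ ℚP.toℚᵘ-homo-+ (fromℚᵘ v) (fromℚᵘ w) ⟨
    toℚᵘ (fromℚᵘ v ℚ.+ fromℚᵘ w)            ∎)
  where
  open ℚᵘP.≤-Reasoning
  u v w : ℚᵘ
  u = mkℚᵘ (+ A) j
  v = mkℚᵘ (+ B) k
  w = mkℚᵘ (+ 1) k
  eq : ∀ J K → suc B ℕ.* J ℕ.* K ≡ (B ℕ.* K ℕ.+ 1 ℕ.* K) ℕ.* J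
  eq J K = trans (ℕP.*-assoc (suc B) J K)
    (trans (cong (suc B ℕ.*_) (ℕP.*-comm J K))
    (trans (sym (ℕP.*-assoc (suc B) K J))
    (cong (ℕ._* J) (trans (ℕP.+-comm K (B ℕ.* K))
      (cong (B ℕ.* K ℕ.+_) (sym (ℕP.*-identityˡ K)))))))
  ineqℕ : A ℕ.* (suc k ℕ.* suc k) ℕ.≤ (B ℕ.* suc k ℕ.+ 1 ℕ.* suc k) ℕ.* suc j
  ineqℕ = ℕP.≤-trans (ℕP.≤-reflexive (sym (ℕP.*-assoc A (suc k) (suc k))))
    (ℕP.≤-trans (ℕP.*-monoˡ-≤ (suc k) h) (ℕP.≤-reflexive (eq (suc j) (suc k))))
  ineq : + A ℤ.* ℚᵘ.↧ (v ℚᵘ.+ w) ℤ.≤ ℚᵘ.↥ (v ℚᵘ.+ w) ℤ.* + suc j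
  ineq = subst₂ ℤ._≤_
    (ℤP.pos-* A (suc k ℕ.* suc k))
    (trans (ℤP.pos-* (B ℕ.* suc k ℕ.+ 1 ℕ.* suc k) (suc j))
      (cong (ℤ._* + suc j) (trans (ℤP.pos-+ (B ℕ.* suc k) (1 ℕ.* suc k))
        (cong₂ ℤ._+_ (ℤP.pos-* B (suc k)) (ℤP.pos-* 1 (suc k))))))
    (ℤ.+≤+ ineqℕ)

1/suc-small : ∀ ε → 0ℚ ℚ.< ε → ∀ k → ↧ₙ ε ℕ.≤ k → + 1 ℚ./ suc k ℚ.≤ ε
1/suc-small ε@(mkℚ (+ suc p) d _) 0<ε k d<k = ℚP.toℚᵘ-cancel-≤
  (ℚᵘP.≤-respˡ-≃ (ℚᵘP.≃-sym (ℚP.toℚᵘ-fromℚᵘ (mkℚᵘ (+ 1) k)))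
    (ℚᵘ.*≤* (subst₂ ℤ._≤_ (ℤP.pos-* 1 (suc d)) (ℤP.pos-* (suc p) (suc k))
      (ℤ.+≤+ (ℕP.*-mono-≤ {1} {suc p} (s≤s z≤n) (ℕP.m≤n⇒m≤1+n d<k))))))
1/suc-small (mkℚ (+ zero) d _) (ℚ.*<* (ℤ.+<+ ()))
1/suc-small (mkℚ -[1+ p ] d _) (ℚ.*<* ())

abs-≤ : ∀ p ε → p ℚ.≤ ε → ℚ.- p ℚ.≤ ε → ℚ.∣ p ∣ ℚ.≤ ε
abs-≤ p ε h h′ with ℚP.∣p∣≡p∨∣p∣≡-p p
... | inj₁ e = subst (ℚ._≤ ε) (sym e) h
... | inj₂ e = subst (ℚ._≤ ε) (sym e) h′

close⇒cauchy : (x e : ℕ → ℚ) →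
  (∀ j k → x j ℚ.≤ x k ℚ.+ e k) →
  (∀ ε → 0ℚ ℚ.< ε → Σ[ N ∈ ℕ ] (∀ k → N ℕ.≤ k → e k ℚ.≤ ε)) →
  CauchyProp x
close⇒cauchy x e close small ε 0<ε with small ε 0<ε
... | N , e≤ε = N , λ i j hi hj →
    abs-≤ (x i ℚ.- x j) ε (one i j hj)
      (ℚP.≤-trans (ℚP.≤-reflexive (flip (x i) (x j))) (one j i hi))
  where
  cancel : ∀ a b → (b ℚ.+ a) ℚ.- b ≡ a
  cancel = solve 2 (λ a b → (b :+ a) :- b := a) refl
    where open +-*-Solver
  flip : ∀ a b → ℚ.- (a ℚ.- b) ≡ b ℚ.- a
  flip = solve 2 (λ a b → :- (a :- b) := b :- a) refl
    where open +-*-Solver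
  one : ∀ i j → N ℕ.≤ j → x i ℚ.- x j ℚ.≤ ε
  one i j hj = ℚP.≤-trans (ℚP.+-monoˡ-≤ (ℚ.- x j) (close i j))
    (ℚP.≤-trans (ℚP.≤-reflexive (cancel (e j) (x j))) (e≤ε j hj))

log₂-floor : ℕ → ℕ → ℕ
log₂-floor n k = ⌊log₂ n ^ suc k ⌋

log₂-floor-close : ∀ n j k →
  log₂-floor n j ℕ.* suc k ℕ.≤ suc (log₂-floor n k) ℕ.* suc j
log₂-floor-close zero    j k = z≤n
log₂-floor-close n@(suc _) j k =
  exponent-≤ n (suc j) (suc k) (log₂-floor n j) (suc (log₂-floor n k))
    (proj₁ (⌊log₂⌋-bounds (n ^ suc j) {{ℕP.m^n≢0 n (suc j)}}))
    (proj₂ (⌊log₂⌋-bounds (n ^ suc k) {{ℕP.m^n≢0 n (suc k)}}))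

log₂-approx : ℕ → ℕ → ℚ
log₂-approx n k = + log₂-floor n k ℚ./ suc k

abstract
  log₂-cauchy : ∀ n → CauchyProp (log₂-approx n)
  log₂-cauchy n = close⇒cauchy (log₂-approx n) (λ k → + 1 ℚ./ suc k)
    (λ j k → fraction-≤ (log₂-floor n j) (log₂-floor n k) j k (log₂-floor-close n j k))
    (λ ε 0<ε → ↧ₙ ε , 1/suc-small ε 0<ε)

-- ⌊log₂ nᵏ⌋ / k is within 1/k of the logarithm.  At n = 0 the value is 0.
log₂ : ℕ → ℝ
log₂ n = mkℝ (log₂-approx n) (log₂-cauchy n)

-- 2^(p/q) ≤ m, after raising to the power q > 0.
2^ℚ_≤_ : ℚ → ℕ → Set
2^ℚ r ≤ m with ↥ r
... | + p      = 2 ^ p ℕ.≤ m ^ ↧ₙ r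
... | -[1+ p ] = 1 ℕ.≤ 2 ^ suc p ℕ.* m ^ ↧ₙ r

-- 2^x is the supremum of 2^r over the rationals r < x.
2^_≤_ : ℝ → ℕ → Set
2^ x ≤ m = ∀ r → fromℚ r <ᵣ x → 2^ℚ r ≤ m

Facility : ℕ → Set
Facility n = Fin (n ^ 2)

Client : ℕ → ℕ → Set
Client a n = Fin (a ℕ.* n ^ 4)

-- Vectors of ℝᵈ, d = n² + a n⁶, with coordinates indexed by facilities
-- and by facility-client pairs.  Used for points (y , x), for objectives
-- (f , c) and for the rows of a constraint matrix.
record Vec (a n : ℕ) : Set where
  constructor _,,_
  field
    fac  : Facility n → ℝ
    pair : Facility n → Client a n → ℝ

open Vec public

module _ {a n : ℕ} where

  infix  4 _≋_
  infixl 7 _∙_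

  _≋_ : Vec a n → Vec a n → Set
  u ≋ v = (∀ i → fac u i ≈ᵣ fac v i) × (∀ i j → pair u i j ≈ᵣ pair v i j)

  _∙_ : Vec a n → Vec a n → ℝ
  u ∙ v = ∑ (λ i → fac u i *ᵣ fac v i)
       +ᵣ ∑ (λ i → ∑ (λ j → pair u i j *ᵣ pair v i j))

  combination : ∀ {k} → (Fin k → ℝ) → (Fin k → Vec a n) → Vec a n
  combination t p = (λ i → ∑ λ s → t s *ᵣ fac (p s) i)
                 ,, (λ i j → ∑ λ s → t s *ᵣ pair (p s) i j)

  conv : (Vec a n → Set) → (Vec a n → Set)
  conv S z = ∃[ k ] Σ[ t ∈ (Fin k → ℝ) ] Σ[ p ∈ (Fin k → Vec a n) ]
      (∀ s → 0ᵣ ≤ᵣ t s)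
    × ∑ t ≈ᵣ 1ᵣ
    × (∀ s → S (p s))
    × z ≋ combination t p

  Polyhedron : ∀ {m} → (Fin m → Vec a n) → (Fin m → ℝ) → (Vec a n → Set)
  Polyhedron A b z = ∀ k → A k ∙ z ≤ᵣ b k

-- An extended real v is represented by the set of reals ℓ ≤ v, so -∞ is
-- the empty set and +∞ the set of all reals.  This gives every linear
-- program a value, also when it is unbounded or infeasible.
Value : Set₁
Value = ℝ → Set

infix 4 _⊑_

_⊑_ : Value → Value → Set
u ⊑ v = ∀ ℓ → u ℓ → v ℓ

-- g⁻¹ v for g > 0:  ℓ ≤ g⁻¹ v  iff  g ℓ ≤ v.
_⁻¹·_ : ℝ → Value → Value
(g ⁻¹· v) ℓ = v (g *ᵣ ℓ)

minimize : ∀ {a n} → Vec a n → (Vec a n → Set) → Value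
minimize w S ℓ = ∀ z → S z → ℓ ≤ᵣ w ∙ z

-- The capacity is U = n³ and every client has demand 1.
record Solution (a n : ℕ) : Set where
  field
    y : Facility n → Fin 2
    x : Facility n → Client a n → Fin 2
    assigned : ∀ j → sum (λ i → toℕ (x i j)) ≡ 1
    onlyOpen : ∀ i j → toℕ (x i j) ℕ.≤ toℕ (y i)
    capacity : ∀ i → sum (λ j → toℕ (x i j)) ℕ.≤ n ^ 3

module _ {a n : ℕ} where

  toVec : Solution a n → Vec a n
  toVec s = (λ i → fromℕ (toℕ (y i))) ,, (λ i j → fromℕ (toℕ (x i j)))
    where open Solution s

  P₀ : Vec a n → Set
  P₀ z = Σ[ s ∈ Solution a n ] z ≋ toVec s

  P : Vec a n → Set
  P = conv P₀

  record Admissible (w : Vec a n) : Set where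
    field
      opening≥0    : ∀ i → 0ᵣ ≤ᵣ fac w i
      connection≥0 : ∀ i j → 0ᵣ ≤ᵣ pair w i j
      metric       : ∀ i i′ j j′ →
        pair w i j ≤ᵣ pair w i′ j +ᵣ pair w i′ j′ +ᵣ pair w i j′

  record ApproximateFormulation (g : ℝ) {m : ℕ}
         (A : Fin m → Vec a n) (b : Fin m → ℝ) : Set where
    field
      relaxation : ∀ w →
        minimize w (Polyhedron A b) ⊑ minimize w P
      gap : ∀ w → Admissible w →
        g ⁻¹· minimize w P ⊑ minimize w (Polyhedron A b)

{-# OPTIONS --safe #-}
module Submission where

-- Put k = n − a, K = k − 1, U = n³.  Fix a facility, the hub, and k disjoint
-- groups of n facilities.  A choice φ of one site per group yields a metric
-- with distances 0 and 1 whose near side holds the hub, the k sites and kU + 1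
-- clients; only the hub has an opening cost, namely 1.  The sites alone cannot
-- serve the near clients, so every integer solution costs at least 1.
--
-- The point z(φ) is an average of k K pseudo-solutions.  In the fraction 1/k
-- of them with open hub, one client of each site moves to the hub; in all the
-- others the hub is closed and one site r serves U + 1 clients.  Hence z(φ)
-- costs 1/k, which is too cheap once K ≥ g, so some inequality cuts it off.
-- The averaged point does not depend on r.  If φ and ψ differ at r, then
-- z(φ) + z(ψ) can be written with pseudo-solutions overloading group r only;
-- a single client of r changing sides between φ and ψ repairs each pair, so
-- the midpoint of z(φ) and z(ψ) lies in P.  No inequality therefore cuts off
-- two of these points, and there are nᵏ of them.

open import Defs
open import Data.Nat as ℕ using (ℕ; zero; suc; pred; _≤_; _<_; _^_; _<?_; _≤?_; z≤n; s≤s)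
import Data.Nat.Properties as ℕP
open import Data.Nat.DivMod using (_%_; _/_; _mod_; %-distribˡ-+; m%n%n≡m%n; [m+n]%n≡m%n; m<n⇒m%n≡m;
  m≡m%n+[m/n]*n; m<n*o⇒m/o<n; m≥n⇒m/n>0; m%n<n)
open import Data.Nat.Solver using () renaming (module +-*-Solver to ℕ-Solver)
open import Data.Integer as ℤ using (+_; -[1+_])
import Data.Integer.Properties as ℤP
open import Data.Rational as ℚ using (ℚ; 0ℚ; 1ℚ; mkℚ; toℚᵘ; fromℚᵘ)
import Data.Rational.Properties as ℚP
open import Data.Rational.Solver using (module +-*-Solver)
open import Data.Rational.Unnormalised as ℚᵘ using (ℚᵘ; mkℚᵘ)
import Data.Rational.Unnormalised.Properties as ℚᵘP
open import Data.Fin as Fin using (Fin; zero; suc; toℕ; fromℕ<; punchIn; _≟_; _↑ˡ_; _↑ʳ_; inject≤; cast;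
  splitAt; remQuot; combine; finToFun; funToFin)
import Data.Fin.Properties as FinP
open import Data.Fin.Permutation using (Permutation; permutation)
open import Data.Bool using (Bool; true; false; if_then_else_; _∧_; _∨_; _xor_; not)
open import Data.Product using (Σ-syntax; ∃; _×_; _,_; proj₁; proj₂; uncurry)
open import Data.Sum using (inj₁; inj₂)
open import Data.Empty using (⊥; ⊥-elim)
open import Function using (_∘_)
open import Relation.Nullary using (Dec; does; yes; no; ¬_)
open import Relation.Nullary.Decidable using (dec-true; dec-false; decidable-stable)
open import Relation.Nullary.Negation using (contradiction)
open import Relation.Binary.PropositionalEquality
open import Algebra.Bundles using (CommutativeRing)
open import Algebra.Properties.Semiring.Sum ℕP.+-*-semiring as Σℕ using (sum)
open import Algebra.Properties.Semiring.Sum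
  (CommutativeRing.semiring ℚP.+-*-commutativeRing) as Σℚ using () renaming (sum to sumℚ)

-- Truth values as numbers

bit : Bool → Fin 2
bit b = if b then suc zero else zero

bitℕ : Bool → ℕ
bitℕ b = toℕ (bit b)

natℚ : ℕ → ℚ
natℚ m = + m ℚ./ 1

bitℚ : Bool → ℚ
bitℚ b = natℚ (bitℕ b)

-- Finite sums

sum-mono : ∀ {N} {f g : Fin N → ℕ} → (∀ i → f i ≤ g i) → sum f ≤ sum g
sum-mono {zero}  f≤g = z≤n
sum-mono {suc N} f≤g = ℕP.+-mono-≤ (f≤g zero) (sum-mono (λ i → f≤g (suc i)))

sum-const : ∀ N c → sum {N} (λ _ → c) ≡ N ℕ.* c
sum-const zero    c = refl
sum-const (suc N) c = cong (c ℕ.+_) (sum-const N c)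

term≤sum : ∀ {N} (f : Fin N → ℕ) i → f i ≤ sum f
term≤sum f zero    = ℕP.m≤m+n (f zero) _
term≤sum f (suc i) = ℕP.≤-trans (term≤sum (λ j → f (suc j)) i) (ℕP.m≤n+m _ (f zero))

sum-zero : ∀ {N} (f : Fin N → ℕ) → (∀ i → f i ≡ 0) → sum f ≡ 0
sum-zero {zero}  f f≡0 = refl
sum-zero {suc N} f f≡0 = cong₂ ℕ._+_ (f≡0 zero) (sum-zero (λ i → f (suc i)) (λ i → f≡0 (suc i)))

sum-indicator : ∀ {N} (c : Fin N) → sum (λ i → bitℕ (does (c ≟ i))) ≡ 1
sum-indicator {suc N} zero    = cong suc (sum-zero {N} (λ i → 0) (λ i → refl))
sum-indicator         (suc c) = sum-indicator c

count-below : ∀ L {M} → L ≤ M → sum {M} (λ j → bitℕ (toℕ j ℕ.<ᵇ L)) ≡ L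
count-below zero    {M}     h       = sum-zero {M} (λ j → 0) (λ j → refl)
count-below (suc L) {suc M} (s≤s h) = cong suc (count-below L h)

at-most-one : ∀ {N} (f : Fin N → Bool) → (∀ i j → f i ≡ true → f j ≡ true → i ≡ j) →
  sum (λ i → bitℕ (f i)) ≤ 1
at-most-one {zero}  f unique = z≤n
at-most-one {suc N} f unique with f zero in eq
... | false = at-most-one (λ i → f (suc i))
                (λ i j p q → FinP.suc-injective (unique (suc i) (suc j) p q))
... | true  = ℕP.≤-reflexive (cong suc (sum-zero _ rest))
  where
  rest : ∀ i → bitℕ (f (suc i)) ≡ 0
  rest i with f (suc i) in eq′
  ... | false = refl
  ... | true  with () ← unique zero (suc i) eq eq′

does-true : ∀ {A : Set} (d : Dec A) → does d ≡ true → A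
does-true (yes a) _ = a

∧-true : ∀ {x y} → (x ∧ y) ≡ true → x ≡ true × y ≡ true
∧-true {true} {true} _ = refl , refl

-- Count the clients at `i` by slot. Facility and slot together determine a client, so each of the
-- `U` slots holds at most one.
load-bound : ∀ {M N U} (A : Fin M → Fin N) (slot : Fin M → Fin U) →
  (∀ j j′ → A j ≡ A j′ → slot j ≡ slot j′ → j ≡ j′) →
  ∀ i → sum (λ j → bitℕ (does (A j ≟ i))) ≤ U
load-bound {M} {N} {U} A slot inj i = begin
  sum (λ j → bitℕ (does (A j ≟ i)))
    ≤⟨ sum-mono (λ j → split (does (A j ≟ i)) (slot j)) ⟩
  sum (λ j → sum (λ s → here j s))
    ≡⟨ Σℕ.∑-comm here ⟩
  sum (λ s → sum (λ j → here j s))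
    ≤⟨ sum-mono (λ s → at-most-one (λ j → does (A j ≟ i) ∧ does (slot j ≟ s)) (single s)) ⟩
  sum {U} (λ s → 1)
    ≡⟨ trans (sum-const U 1) (ℕP.*-identityʳ U) ⟩
  U ∎
  where
  open ℕP.≤-Reasoning
  here : Fin M → Fin U → ℕ
  here j s = bitℕ (does (A j ≟ i) ∧ does (slot j ≟ s))
  split : ∀ b (t : Fin U) → bitℕ b ≤ sum (λ s → bitℕ (b ∧ does (t ≟ s)))
  split false t = z≤n
  split true  t = ℕP.≤-reflexive (sym (sum-indicator t))
  single : ∀ s j j′ → (does (A j ≟ i) ∧ does (slot j ≟ s)) ≡ true →
    (does (A j′ ≟ i) ∧ does (slot j′ ≟ s)) ≡ true → j ≡ j′
  single s j j′ p q with ∧-true {does (A j ≟ i)} p | ∧-true {does (A j′ ≟ i)} q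
  ... | a , b | a′ , b′ = inj j j′
    (trans (does-true (A j ≟ i) a) (sym (does-true (A j′ ≟ i) a′)))
    (trans (does-true (slot j ≟ s) b) (sym (does-true (slot j′ ≟ s) b′)))

sumℚ-mono : ∀ {N} {f g : Fin N → ℚ} → (∀ i → f i ℚ.≤ g i) → sumℚ f ℚ.≤ sumℚ g
sumℚ-mono {zero}  f≤g = ℚP.≤-refl
sumℚ-mono {suc N} f≤g = ℚP.+-mono-≤ (f≤g zero) (sumℚ-mono (λ i → f≤g (suc i)))

sumℚ-zero : ∀ {N} (f : Fin N → ℚ) → (∀ i → f i ≡ 0ℚ) → sumℚ f ≡ 0ℚ
sumℚ-zero {zero}  f f≡0 = refl
sumℚ-zero {suc N} f f≡0 = cong₂ ℚ._+_ (f≡0 zero) (sumℚ-zero (λ i → f (suc i)) (λ i → f≡0 (suc i)))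

sumℚ-indicator : ∀ {N} (h : Fin N → ℚ) c → sumℚ (λ i → h i ℚ.* bitℚ (does (c ≟ i))) ≡ h c
sumℚ-indicator h zero = trans
  (cong₂ ℚ._+_ (ℚP.*-identityʳ (h zero)) (sumℚ-zero _ (λ i → ℚP.*-zeroʳ (h (suc i)))))
  (ℚP.+-identityʳ (h zero))
sumℚ-indicator h (suc c) = trans
  (cong₂ ℚ._+_ (ℚP.*-zeroʳ (h zero)) (sumℚ-indicator (λ i → h (suc i)) c))
  (ℚP.+-identityˡ (h (suc c)))

-- Rotations of a cycle

module _ {K : ℕ} where

  -- The amount is a natural number because the inverse of a shift by `r` is taken to be the shift
  -- by `suc K ∸ r`, which is out of the range of `Fin (suc K)` at `r = 0`.
  shift : ℕ → Fin (suc K) → Fin (suc K)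
  shift r u = (toℕ u ℕ.+ r) mod suc K

  toℕ-shift : ∀ r u → toℕ (shift r u) ≡ (toℕ u ℕ.+ r) % suc K
  toℕ-shift r u = FinP.toℕ-fromℕ< _

  shift-shift : ∀ r s u → r ℕ.+ s ≡ suc K → shift s (shift r u) ≡ u
  shift-shift r s u r+s = FinP.toℕ-injective (begin
    toℕ (shift s (shift r u))                   ≡⟨ toℕ-shift s (shift r u) ⟩
    (toℕ (shift r u) ℕ.+ s) % suc K             ≡⟨ cong (λ t → (t ℕ.+ s) % suc K) (toℕ-shift r u) ⟩
    ((toℕ u ℕ.+ r) % suc K ℕ.+ s) % suc K       ≡⟨ %-distribˡ-+ ((toℕ u ℕ.+ r) % suc K) s (suc K) ⟩
    ((toℕ u ℕ.+ r) % suc K % suc K ℕ.+ s % suc K) % suc K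
      ≡⟨ cong (λ t → (t ℕ.+ s % suc K) % suc K) (m%n%n≡m%n (toℕ u ℕ.+ r) (suc K)) ⟩
    ((toℕ u ℕ.+ r) % suc K ℕ.+ s % suc K) % suc K
      ≡⟨ %-distribˡ-+ (toℕ u ℕ.+ r) s (suc K) ⟨
    (toℕ u ℕ.+ r ℕ.+ s) % suc K                 ≡⟨ cong (_% suc K) (ℕP.+-assoc (toℕ u) r s) ⟩
    (toℕ u ℕ.+ (r ℕ.+ s)) % suc K               ≡⟨ cong (λ t → (toℕ u ℕ.+ t) % suc K) r+s ⟩
    (toℕ u ℕ.+ suc K) % suc K                   ≡⟨ [m+n]%n≡m%n (toℕ u) (suc K) ⟩
    toℕ u % suc K                               ≡⟨ m<n⇒m%n≡m (FinP.toℕ<n u) ⟩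
    toℕ u ∎)
    where open ≡-Reasoning

  infixl 6 _⊕_

  _⊕_ : Fin (suc K) → Fin (suc K) → Fin (suc K)
  u ⊕ ρ = shift (toℕ ρ) u

  ⊕-comm : ∀ u ρ → u ⊕ ρ ≡ ρ ⊕ u
  ⊕-comm u ρ = cong (_mod suc K) (ℕP.+-comm (toℕ u) (toℕ ρ))

  ⊕-permutation : Fin (suc K) → Permutation (suc K) (suc K)
  ⊕-permutation ρ = permutation (_⊕ ρ) (shift s)
    (λ u → shift-shift s (toℕ ρ) u s+ρ) (λ u → shift-shift (toℕ ρ) s u (trans (ℕP.+-comm (toℕ ρ) s) s+ρ))
    where
    s : ℕ
    s = suc K ℕ.∸ toℕ ρ
    s+ρ : s ℕ.+ toℕ ρ ≡ suc K
    s+ρ = ℕP.m∸n+n≡m (ℕP.<⇒≤ (FinP.toℕ<n ρ))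

  ⊕-cancelʳ : ∀ ρ {u u′} → u ⊕ ρ ≡ u′ ⊕ ρ → u ≡ u′
  ⊕-cancelʳ ρ {u} {u′} eq = trans (sym (back u)) (trans (cong (shift s) eq) (back u′))
    where
    s : ℕ
    s = suc K ℕ.∸ toℕ ρ
    back : ∀ u → shift s (u ⊕ ρ) ≡ u
    back u = shift-shift (toℕ ρ) s u (ℕP.m+[n∸m]≡n (ℕP.<⇒≤ (FinP.toℕ<n ρ)))

  -- By commutativity `u ⊕ ρ` is also `ρ` rotated by `u`, so letting `ρ` run only permutes the
  -- terms.
  sum-rotate : ∀ (f : Fin (suc K) → ℚ) u → sumℚ (λ ρ → f (u ⊕ ρ)) ≡ sumℚ f
  sum-rotate f u = trans
    (Σℚ.sum-cong-≗ (λ ρ → cong f (⊕-comm u ρ)))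
    (sym (Σℚ.sum-permute f (⊕-permutation u)))

-- Scenarios

data Place (n k L : ℕ) : Set where
  hub    : Place n k L
  site   : Fin k → Fin n → Place n k L
  remote : Fin L → Place n k L

-- base p b is served by the site of group p, except that base p zero is the
-- client of p that an open hub takes over.  The K² clients float u v have the
-- same marginal at every site.  A far client stays with its remote facility;
-- its second argument is its slot there.
data Kind (K B L U : ℕ) : Set where
  base  : Fin (suc K) → Fin (suc B) → Kind K B L U
  float : Fin K → Fin K → Kind K B L U
  far   : Fin L → Fin U → Kind K B L U

↑ˡ≢↑ʳ : ∀ {m n} (i : Fin m) (j : Fin n) → i ↑ˡ n ≢ m ↑ʳ j
↑ˡ≢↑ʳ {m} {n} i j eq with () ←
  trans (sym (FinP.splitAt-↑ˡ m i n)) (trans (cong (Fin.splitAt m) eq) (FinP.splitAt-↑ʳ m n j))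

module Scheme {n K₀ B₀ L : ℕ} where

  K k B U : ℕ
  K = suc K₀
  k = suc K
  B = suc B₀
  U = B ℕ.+ K

  Pl Kd Choice : Set
  Pl = Place n k L
  Kd = Kind K B L U
  Choice = Fin k → Fin n

  -- τ = zero is the scenario with open hub, and ρ rotates the sites.  Over all
  -- (τ , ρ) the client float u v visits every site K times: site r at
  -- τ = suc v, and each site other than r once for every other τ.
  floatPosition : Fin k → Fin k → Fin K → Fin K → Fin K → Fin k
  floatPosition r τ ρ u v = if does (τ ≟ suc v) then r else punchIn r (u ⊕ ρ)

  target : Fin k → Kd → Fin k → Fin K → Choice → Pl
  target r (base p zero)    zero    ρ φ = hub
  target r (base p zero)    (suc τ) ρ φ = site p (φ p)
  target r (base p (suc b)) τ       ρ φ = site p (φ p)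
  target r (float u v)      τ       ρ φ = site q (φ q)
    where q = floatPosition r τ ρ u v
  target r (far t s)        τ       ρ φ = remote t

  isPivot : Fin k → Kd → Bool
  isPivot r (base p zero) = does (p ≟ r)
  isPivot r _             = false

  -- Site r is overloaded by exactly one client when the hub is closed, so it
  -- is enough to separate base r zero from the rest.
  mixed : Fin k → Kd → Fin k → Fin K → Choice → Choice → Pl
  mixed r κ τ ρ φ ψ = target r κ τ ρ (if isPivot r κ then φ else ψ)

  -- Clients sharing a facility under mixed have distinct slots, which bounds
  -- the load by U.  At site r and τ = suc v the floats are exactly those with
  -- second index v, hence are told apart by their first index.
  slot : Kd → Fin k → Fin U
  slot (base p zero)    zero    = inject≤ p (s≤s (ℕP.m≤n+m K B₀))
  slot (base p zero)    (suc τ) = B ↑ʳ τ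
  slot (base p (suc b)) τ       = b ↑ˡ K
  slot (float u v)      τ       = B ↑ʳ (if does (τ ≟ suc v) then u else v)
  slot (far t s)        τ       = s

  site-injective : ∀ {p p′ c c′} → site {n} {k} {L} p c ≡ site p′ c′ → p ≡ p′ × c ≡ c′
  site-injective refl = refl , refl

  module _ (r : Fin k) (ρ : Fin K) (φ ψ : Choice) (φ≢ψ : φ r ≢ ψ r) where

    -- Floats with `v ≠ τ` have another slot. Those with `v = τ` are all at the site of group `r`
    -- chosen by `ψ`, where `base p zero` never is: for `p ≠ r` its group differs, and for `p = r`
    -- it was moved to `φ r`.
    pivot-vs-float : ∀ τ p u v → mixed r (base p zero) (suc τ) ρ φ ψ ≡ mixed r (float u v) (suc τ) ρ φ ψ →
      slot (base p zero) (suc τ) ≡ slot (float u v) (suc τ) → ⊥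
    pivot-vs-float τ p u v eq eqₛ with τ ≟ v
    pivot-vs-float τ p u v eq eqₛ | yes _ with p ≟ r
    ... | yes refl = φ≢ψ (proj₂ (site-injective eq))
    ... | no p≢r = p≢r (proj₁ (site-injective eq))
    pivot-vs-float τ p u v eq eqₛ | no τ≢v = τ≢v (FinP.↑ʳ-injective B τ v eqₛ)

    pivots : ∀ τ p p′ → mixed r (base p zero) (suc τ) ρ φ ψ ≡ mixed r (base p′ zero) (suc τ) ρ φ ψ → p ≡ p′
    pivots τ p p′ eq = proj₁ (site-injective eq)

    base-vs-float : ∀ τ p b u v → slot (base p (suc b)) τ ≢ slot (float u v) τ
    base-vs-float τ p b u v = ↑ˡ≢↑ʳ b (if does (τ ≟ suc v) then u else v)

    -- Floats with `τ = suc v` are at group `r`, all others elsewhere, so two floats at one site are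
    -- of the same sort. In the first sort `v` is fixed and the slot gives `u`; in the second the
    -- site gives `u` and the slot gives `v`.
    floats : ∀ τ u v u′ v′ → mixed r (float u v) τ ρ φ ψ ≡ mixed r (float u′ v′) τ ρ φ ψ →
      slot (float u v) τ ≡ slot (float u′ v′) τ → float {K} {B} {L} {U} u v ≡ float u′ v′
    floats τ u v u′ v′ eq eqₛ with τ ≟ suc v | τ ≟ suc v′
    ... | yes refl | yes refl = cong (λ u → float u v) (FinP.↑ʳ-injective B u u′ eqₛ)
    ... | yes _    | no _     = contradiction (sym (proj₁ (site-injective eq))) (FinP.punchInᵢ≢i r _)
    ... | no _     | yes _    = contradiction (proj₁ (site-injective eq)) (FinP.punchInᵢ≢i r _)
    ... | no _     | no _     = cong₂ float
      (⊕-cancelʳ ρ (FinP.punchIn-injective r _ _ (proj₁ (site-injective eq))))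
      (FinP.↑ʳ-injective B v v′ eqₛ)

    mixed-slot-injective : ∀ τ κ κ′ → mixed r κ τ ρ φ ψ ≡ mixed r κ′ τ ρ φ ψ →
      slot κ τ ≡ slot κ′ τ → κ ≡ κ′
    mixed-slot-injective zero (base p zero) (base p′ zero) eq eqₛ =
      cong (λ p → base p zero) (FinP.inject≤-injective _ _ p p′ eqₛ)
    mixed-slot-injective (suc τ) (base p zero) (base p′ zero) eq eqₛ =
      cong (λ p → base p zero) (pivots τ p p′ eq)
    mixed-slot-injective (suc τ) (base p zero) (base p′ (suc b′)) eq eqₛ = ⊥-elim (↑ˡ≢↑ʳ b′ τ (sym eqₛ))
    mixed-slot-injective (suc τ) (base p zero) (float u v) eq eqₛ = ⊥-elim (pivot-vs-float τ p u v eq eqₛ)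
    mixed-slot-injective (suc τ) (base p (suc b)) (base p′ zero) eq eqₛ = ⊥-elim (↑ˡ≢↑ʳ b τ eqₛ)
    mixed-slot-injective τ (base p (suc b)) (base p′ (suc b′)) eq eqₛ =
      cong₂ base (proj₁ (site-injective eq)) (cong suc (FinP.↑ˡ-injective K b b′ eqₛ))
    mixed-slot-injective τ (base p (suc b)) (float u v) eq eqₛ = ⊥-elim (base-vs-float τ p b u v eqₛ)
    mixed-slot-injective (suc τ) (float u v) (base p zero) eq eqₛ =
      ⊥-elim (pivot-vs-float τ p u v (sym eq) (sym eqₛ))
    mixed-slot-injective τ (float u v) (base p (suc b)) eq eqₛ = ⊥-elim (base-vs-float τ p b u v (sym eqₛ))
    mixed-slot-injective τ (float u v) (float u′ v′) eq eqₛ = floats τ u v u′ v′ eq eqₛ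
    mixed-slot-injective zero    (far t s) (base p zero)    ()
    mixed-slot-injective (suc τ) (far t s) (base p zero)    ()
    mixed-slot-injective τ       (far t s) (base p (suc b)) ()
    mixed-slot-injective τ (far t s) (far .t s′) refl eqₛ = cong (far t) eqₛ

  target-sum : (F : Pl → ℚ) (φ : Choice) (r : Fin k) (u v : Fin K) →
    sumℚ (λ τ → sumℚ (λ ρ → F (target r (float u v) τ ρ φ))) ≡
    sumℚ {K} (λ ρ → sumℚ (λ q → F (site q (φ q))))
  target-sum F φ r u v = begin
    sumℚ (λ τ → sumℚ (λ ρ → G (floatPosition r τ ρ u v)))
      ≡⟨ Σℚ.sum-remove {i = suc v} (λ τ → sumℚ (λ ρ → G (floatPosition r τ ρ u v))) ⟩
    sumℚ (λ ρ → G (floatPosition r (suc v) ρ u v)) ℚ.+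
    sumℚ (λ σ → sumℚ (λ ρ → G (floatPosition r (punchIn (suc v) σ) ρ u v)))
      ≡⟨ cong₂ ℚ._+_ (Σℚ.sum-cong-≗ (λ ρ → cong G (hit ρ)))
           (Σℚ.sum-cong-≗ (λ σ → trans (Σℚ.sum-cong-≗ (λ ρ → cong G (miss σ ρ)))
             (sum-rotate (λ x → G (punchIn r x)) u))) ⟩
    -- The `K` visits to `r` are dealt out, one to each of the `K` values of `τ` other than `suc v`,
    -- which completes each of these to a sum over all sites.
    sumℚ {K} (λ σ → G r) ℚ.+ sumℚ {K} (λ σ → sumℚ (λ ρ → G (punchIn r ρ)))
      ≡⟨ Σℚ.∑-distrib-+ {K} (λ σ → G r) (λ σ → sumℚ (λ ρ → G (punchIn r ρ))) ⟨
    sumℚ {K} (λ σ → G r ℚ.+ sumℚ (λ ρ → G (punchIn r ρ)))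
      ≡⟨ Σℚ.sum-cong-≗ {K} (λ σ → Σℚ.sum-remove {i = r} G) ⟨
    sumℚ {K} (λ σ → sumℚ G) ∎
    where
    open ≡-Reasoning
    G : Fin k → ℚ
    G q = F (site q (φ q))
    hit : ∀ ρ → floatPosition r (suc v) ρ u v ≡ r
    hit ρ with v ≟ v
    ... | yes _ = refl
    ... | no v≢v = contradiction refl v≢v
    miss : ∀ σ ρ → floatPosition r (punchIn (suc v) σ) ρ u v ≡ punchIn r (u ⊕ ρ)
    miss σ ρ with punchIn (suc v) σ ≟ suc v
    ... | yes e = contradiction e (FinP.punchInᵢ≢i (suc v) σ)
    ... | no _ = refl

  -- The point of a choice is fixed before it is known in which group it will be compared with
  -- another choice, so the marginals of every client must agree for all `r`. For floats the right
  -- side of `target-sum` is free of `r`.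
  target-sum-independent : (F : Pl → ℚ) (φ : Choice) (r r′ : Fin k) (κ : Kd) →
    sumℚ (λ τ → sumℚ (λ ρ → F (target r κ τ ρ φ))) ≡
    sumℚ (λ τ → sumℚ (λ ρ → F (target r′ κ τ ρ φ)))
  target-sum-independent F φ r r′ (base p zero)    = refl
  target-sum-independent F φ r r′ (base p (suc b)) = refl
  target-sum-independent F φ r r′ (float u v)      =
    trans (target-sum F φ r u v) (sym (target-sum F φ r′ u v))
  target-sum-independent F φ r r′ (far t s)        = refl

  -- Each client has the same two targets on both sides: the pivot in the original order, all others
  -- in the reversed order.
  mixed-swap : (F : Pl → ℚ) (φ ψ : Choice) (r : Fin k) (τ : Fin k) (ρ : Fin K) (κ : Kd) →
    F (mixed r κ τ ρ φ ψ) ℚ.+ F (mixed r κ τ ρ ψ φ) ≡ F (target r κ τ ρ φ) ℚ.+ F (target r κ τ ρ ψ)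
  mixed-swap F φ ψ r τ ρ κ with isPivot r κ
  ... | true  = refl
  ... | false = ℚP.+-comm (F (target r κ τ ρ ψ)) (F (target r κ τ ρ φ))

-- Numbering of facilities and clients

module Layout (a n K₀ B₀ L : ℕ)
  (capacity-eq : suc B₀ ℕ.+ suc K₀ ≡ n ^ 3)
  (facility-eq : suc (L ℕ.+ suc (suc K₀) ℕ.* n) ≡ n ^ 2)
  (remote-eq : suc L ℕ.* n ^ 3 ≡ a ℕ.* n ^ 4)
  (home-fits : suc (suc (suc K₀) ℕ.* n ^ 3) ≤ a ℕ.* n ^ 4)
  where

  open Scheme {n} {K₀} {B₀} {L} public

  place : Pl → Fin (suc (L ℕ.+ k ℕ.* n))
  place hub        = zero
  place (remote t) = suc (t ↑ˡ (k ℕ.* n))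
  place (site p c) = suc (L ↑ʳ combine p c)

  place-injective : ∀ x y → place x ≡ place y → x ≡ y
  place-injective hub        hub          eq = refl
  place-injective (remote t) (remote t′)  eq = cong remote (FinP.↑ˡ-injective _ t t′ (FinP.suc-injective eq))
  place-injective (site p c) (site p′ c′) eq with FinP.combine-injective p c p′ c′
                                                    (FinP.↑ʳ-injective L _ _ (FinP.suc-injective eq))
  ... | refl , refl = refl
  place-injective (remote t) (site p c)   eq = ⊥-elim (↑ˡ≢↑ʳ t _ (FinP.suc-injective eq))
  place-injective (site p c) (remote t)   eq = ⊥-elim (↑ˡ≢↑ʳ t _ (sym (FinP.suc-injective eq)))

  facility : Pl → Facility n
  facility x = cast facility-eq (place x)

  facility-injective : ∀ {x y} → facility x ≡ facility y → x ≡ y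
  facility-injective {x} {y} eq = place-injective x y (FinP.toℕ-injective
    (trans (sym (FinP.toℕ-cast facility-eq (place x)))
      (trans (cong toℕ eq) (FinP.toℕ-cast facility-eq (place y)))))

  homes : ℕ
  homes = K ℕ.* K ℕ.+ k ℕ.* suc B

  -- One client more than the `k` sites can hold. This excess is the source of the integrality gap.
  homes-eq : homes ≡ suc (k ℕ.* U)
  homes-eq = solve 2 (λ K B → K :* K :+ (con 1 :+ K) :* (con 1 :+ B) :=
    con 1 :+ (con 1 :+ K) :* (B :+ K)) refl K B
    where open ℕ-Solver

  homeKind : Fin homes → Kd
  homeKind i with splitAt (K ℕ.* K) i
  ... | inj₁ x = uncurry float (remQuot K x)
  ... | inj₂ y = uncurry base (remQuot (suc B) y)

  U≤homes : U ≤ homes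
  U≤homes = subst (U ≤_) (sym homes-eq) (ℕP.m≤n⇒m≤1+n (ℕP.m≤m+n U (K ℕ.* U)))

  -- Clients are cut into `suc L` blocks of `U`, the capacity of a remote facility. Block zero
  -- contains home clients only, so `pred` moves the blocks of far clients into `Fin L`.
  remote-bound : ∀ (j : Client a n) → ¬ toℕ j < homes → pred (toℕ j / U) < L
  remote-bound j j≮ = ℕP.<-≤-trans
    (ℕP.≤-reflexive (ℕP.suc-pred (toℕ j / U) {{ℕ.>-nonZero 0<j/U}}))
    (ℕP.≤-pred (m<n*o⇒m/o<n (subst (toℕ j <_) total (FinP.toℕ<n j))))
    where
    0<j/U : 0 < toℕ j / U
    0<j/U = m≥n⇒m/n>0 (ℕP.≤-trans U≤homes (ℕP.≮⇒≥ j≮))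
    total : a ℕ.* n ^ 4 ≡ suc L ℕ.* U
    total = trans (sym remote-eq) (cong (suc L ℕ.*_) (sym capacity-eq))

  kind : Client a n → Kd
  kind j with toℕ j <? homes
  ... | yes j< = homeKind (fromℕ< j<)
  ... | no  j≮ = far (fromℕ< (remote-bound j j≮)) (toℕ j mod U)

  -- Reads the number of a client off its kind, which makes `kind` injective.
  code : Kd → ℕ
  code (float u v) = toℕ (combine u v ↑ˡ (k ℕ.* suc B))
  code (base p b)  = toℕ (K ℕ.* K ↑ʳ combine p b)
  code (far t s)   = toℕ s ℕ.+ suc (toℕ t) ℕ.* U

  code-homeKind : ∀ i → code (homeKind i) ≡ toℕ i
  code-homeKind i with splitAt (K ℕ.* K) i in eq
  ... | inj₁ x = cong toℕ (trans (cong (_↑ˡ _) (FinP.combine-remQuot {K} K x))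
                   (FinP.splitAt⁻¹-↑ˡ eq))
  ... | inj₂ y = cong toℕ (trans (cong (K ℕ.* K ↑ʳ_) (FinP.combine-remQuot {k} (suc B) y))
                   (FinP.splitAt⁻¹-↑ʳ eq))

  code-kind : ∀ j → code (kind j) ≡ toℕ j
  code-kind j with toℕ j <? homes
  ... | yes j< = trans (code-homeKind (fromℕ< j<)) (FinP.toℕ-fromℕ< j<)
  ... | no  j≮ = begin
    toℕ (toℕ j mod U) ℕ.+ suc (toℕ (fromℕ< (remote-bound j j≮))) ℕ.* U
      ≡⟨ cong₂ (λ s t → s ℕ.+ suc t ℕ.* U) (FinP.toℕ-fromℕ< (m%n<n (toℕ j) U))
           (FinP.toℕ-fromℕ< (remote-bound j j≮)) ⟩
    toℕ j % U ℕ.+ suc (pred (toℕ j / U)) ℕ.* U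
      ≡⟨ cong (λ t → toℕ j % U ℕ.+ t ℕ.* U) (ℕP.suc-pred (toℕ j / U)
           {{ℕ.>-nonZero (m≥n⇒m/n>0 (ℕP.≤-trans U≤homes (ℕP.≮⇒≥ j≮)))}}) ⟩
    toℕ j % U ℕ.+ (toℕ j / U) ℕ.* U
      ≡⟨ m≡m%n+[m/n]*n (toℕ j) U ⟨
    toℕ j ∎
    where open ≡-Reasoning

  kind-injective : ∀ {j j′} → kind j ≡ kind j′ → j ≡ j′
  kind-injective {j} {j′} eq = FinP.toℕ-injective
    (trans (sym (code-kind j)) (trans (cong code eq) (code-kind j′)))

  home : Kd → Bool
  home (far t s) = false
  home _         = true

  home-homeKind : ∀ i → home (homeKind i) ≡ true
  home-homeKind i with splitAt (K ℕ.* K) i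
  ... | inj₁ x = refl
  ... | inj₂ y = refl

  home-kind : ∀ j → home (kind j) ≡ (toℕ j ℕ.<ᵇ homes)
  home-kind j with toℕ j <? homes
  ... | yes j< = trans (home-homeKind (fromℕ< j<)) (sym (dec-true (toℕ j <? homes) j<))
  ... | no  j≮ = sym (dec-false (toℕ j <? homes) j≮)

  count-homes : sum (λ j → bitℕ (home (kind j))) ≡ suc (k ℕ.* n ^ 3)
  count-homes = trans (Σℕ.sum-cong-≗ (λ j → cong bitℕ (home-kind j)))
    (trans (count-below homes (subst (_≤ a ℕ.* n ^ 4) (sym homes-eq′) home-fits)) homes-eq′)
    where
    homes-eq′ : homes ≡ suc (k ℕ.* n ^ 3)
    homes-eq′ = trans homes-eq (cong (λ t → suc (k ℕ.* t)) capacity-eq)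

  siteOf : Choice → Fin k → Facility n
  siteOf φ p = facility (site p (φ p))

  isHub : Facility n → Bool
  isHub i = does (facility hub ≟ i)

  abstract
    occupied? : ∀ φ i → Dec (∃ λ p → siteOf φ p ≡ i)
    occupied? φ i = FinP.any? (λ p → siteOf φ p ≟ i)

  near : Choice → Facility n → Bool
  near φ i = isHub i ∨ does (occupied? φ i)

  -- The cut metric between the near and the far side: a connection costs 1 exactly when it crosses
  -- the cut.
  apart : Choice → Facility n → Client a n → Bool
  apart φ i j = near φ i xor home (kind j)

  -- The hub and the sites of `φ` are near and remote facilities are not, so no scenario sends a
  -- client across the cut. The only cost left is the opening of the hub.
  target-near : ∀ φ r τ ρ j → apart φ (facility (target r (kind j) τ ρ φ)) j ≡ false
  target-near φ r τ ρ j = go (kind j) τ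
    where
    at-site : ∀ p → near φ (siteOf φ p) ≡ true
    at-site p with facility hub ≟ siteOf φ p
    ... | yes _ = refl
    ... | no _  = dec-true (occupied? φ (siteOf φ p)) (p , refl)
    at-remote : ∀ t → near φ (facility (remote t)) ≡ false
    at-remote t with facility hub ≟ facility (remote t)
    ... | yes e with () ← facility-injective {hub} {remote t} e
    ... | no _ = dec-false (occupied? φ (facility (remote t)))
                   λ (q , e) → case-absurd q (facility-injective {site q (φ q)} {remote t} e)
      where
      case-absurd : ∀ q → site {n} {k} {L} q (φ q) ≢ remote t
      case-absurd q ()
    go : ∀ κ τ → (near φ (facility (target r κ τ ρ φ)) xor home κ) ≡ false
    go (base p zero) zero = cong (λ b → (b ∨ does (occupied? φ (facility hub))) xor true)
      (dec-true (facility hub ≟ facility hub) refl)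
    go (base p zero) (suc τ) = cong (_xor true) (at-site p)
    go (base p (suc b)) τ = cong (_xor true) (at-site p)
    go (float u v) τ = cong (_xor true) (at-site (floatPosition r τ ρ u v))
    go (far t s) τ = cong (_xor false) (at-remote t)

  -- The cost of integer solutions

  module _ (φ : Choice) (S : Solution a n) where

    open Solution S

    xℕ : Facility n → Client a n → ℕ
    xℕ i j = toℕ (x i j)

    yℕ : Facility n → ℕ
    yℕ i = toℕ (y i)

    hubCost : ℕ
    hubCost = sum (λ i → bitℕ (isHub i) ℕ.* yℕ i)

    travel : Facility n → ℕ
    travel i = sum (λ j → bitℕ (apart φ i j) ℕ.* xℕ i j)

    sites : Facility n → ℕ
    sites i = sum (λ p → bitℕ (does (siteOf φ p ≟ i)))

    clients : ℕ
    clients = a ℕ.* n ^ 4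

    bit≤1 : ∀ b → bitℕ b ≤ 1
    bit≤1 true  = s≤s z≤n
    bit≤1 false = z≤n

    bit*≤ : ∀ b m → bitℕ b ℕ.* m ≤ m
    bit*≤ b m = ℕP.≤-trans (ℕP.*-monoˡ-≤ m (bit≤1 b)) (ℕP.≤-reflexive (ℕP.*-identityˡ m))

    -- Three ways to pay for home clients: an open hub may take all clients, a site takes at most
    -- its capacity, and at any other facility each home client crosses the cut.
    served : ∀ i → sum (λ j → bitℕ (home (kind j)) ℕ.* xℕ i j) ≤
      n ^ 3 ℕ.* sites i ℕ.+ clients ℕ.* (bitℕ (isHub i) ℕ.* yℕ i) ℕ.+ travel i
    served i with facility hub ≟ i
    ... | yes _ = begin
      sum (λ j → bitℕ (home (kind j)) ℕ.* xℕ i j)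
        ≤⟨ sum-mono (λ j → ℕP.≤-trans (bit*≤ (home (kind j)) (xℕ i j)) (onlyOpen i j)) ⟩
      sum {clients} (λ j → yℕ i)                  ≡⟨ sum-const clients (yℕ i) ⟩
      clients ℕ.* yℕ i                            ≡⟨ cong (clients ℕ.*_) (ℕP.*-identityˡ (yℕ i)) ⟨
      clients ℕ.* (1 ℕ.* yℕ i)                    ≤⟨ ℕP.m≤n+m _ (n ^ 3 ℕ.* sites i) ⟩
      n ^ 3 ℕ.* sites i ℕ.+ clients ℕ.* (1 ℕ.* yℕ i) ≤⟨ ℕP.m≤m+n _ _ ⟩
      _ ∎
      where open ℕP.≤-Reasoning
    ... | no _ with occupied? φ i
    ...   | yes (p , e) = begin
      sum (λ j → bitℕ (home (kind j)) ℕ.* xℕ i j)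
        ≤⟨ sum-mono (λ j → bit*≤ (home (kind j)) (xℕ i j)) ⟩
      sum (xℕ i)                                  ≤⟨ capacity i ⟩
      n ^ 3                                      ≡⟨ ℕP.*-identityʳ (n ^ 3) ⟨
      n ^ 3 ℕ.* 1
        ≤⟨ ℕP.*-monoʳ-≤ (n ^ 3) (ℕP.≤-trans
             (ℕP.≤-reflexive (cong bitℕ (sym (dec-true (siteOf φ p ≟ i) e))))
             (term≤sum (λ p → bitℕ (does (siteOf φ p ≟ i))) p)) ⟩
      n ^ 3 ℕ.* sites i                          ≤⟨ ℕP.≤-trans (ℕP.m≤m+n _ _) (ℕP.m≤m+n _ _) ⟩
      _ ∎
      where open ℕP.≤-Reasoning
    -- Off the near side `apart φ i j` reduces to `home (kind j)`, so the left side is `travel i`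
    -- itself.
    ...   | no _ = ℕP.m≤n+m _ _

    total-served : suc (k ℕ.* n ^ 3) ≤ n ^ 3 ℕ.* k ℕ.+ clients ℕ.* hubCost ℕ.+ sum travel
    total-served = begin
      suc (k ℕ.* n ^ 3)                          ≡⟨ count-homes ⟨
      sum h                                      ≡⟨ Σℕ.sum-cong-≗ (λ j → once j) ⟩
      sum (λ j → sum (λ i → h j ℕ.* xℕ i j))      ≡⟨ Σℕ.∑-comm (λ j i → h j ℕ.* xℕ i j) ⟩
      sum (λ i → sum (λ j → h j ℕ.* xℕ i j))      ≤⟨ sum-mono served ⟩
      sum (λ i → n ^ 3 ℕ.* sites i ℕ.+ clients ℕ.* (bitℕ (isHub i) ℕ.* yℕ i) ℕ.+ travel i)
        ≡⟨ Σℕ.∑-distrib-+ (λ i → n ^ 3 ℕ.* sites i ℕ.+ clients ℕ.* (bitℕ (isHub i) ℕ.* yℕ i)) travel ⟩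
      sum (λ i → n ^ 3 ℕ.* sites i ℕ.+ clients ℕ.* (bitℕ (isHub i) ℕ.* yℕ i)) ℕ.+ sum travel
        ≡⟨ cong (ℕ._+ sum travel) (Σℕ.∑-distrib-+ (λ i → n ^ 3 ℕ.* sites i)
             (λ i → clients ℕ.* (bitℕ (isHub i) ℕ.* yℕ i))) ⟩
      sum (λ i → n ^ 3 ℕ.* sites i) ℕ.+ sum (λ i → clients ℕ.* (bitℕ (isHub i) ℕ.* yℕ i)) ℕ.+ sum travel
        ≡⟨ cong₂ (λ s t → s ℕ.+ t ℕ.+ sum travel)
             (trans (sym (Σℕ.*-distribˡ-sum (n ^ 3) sites)) (cong (n ^ 3 ℕ.*_) count-sites))
             (sym (Σℕ.*-distribˡ-sum clients (λ i → bitℕ (isHub i) ℕ.* yℕ i))) ⟩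
      n ^ 3 ℕ.* k ℕ.+ clients ℕ.* hubCost ℕ.+ sum travel ∎
      where
      open ℕP.≤-Reasoning
      h : Client a n → ℕ
      h j = bitℕ (home (kind j))
      once : ∀ j → h j ≡ sum (λ i → h j ℕ.* xℕ i j)
      once j = trans (sym (ℕP.*-identityʳ (h j)))
        (trans (cong (h j ℕ.*_) (sym (assigned j))) (Σℕ.*-distribˡ-sum (h j) (λ i → xℕ i j)))
      count-sites : sum sites ≡ k
      count-sites = trans (sym (Σℕ.∑-comm (λ p i → bitℕ (does (siteOf φ p ≟ i)))))
        (trans (Σℕ.sum-cong-≗ (λ p → sum-indicator (siteOf φ p)))
          (trans (sum-const k 1) (ℕP.*-identityʳ k)))

    -- With a closed hub and no travel, `total-served` would fit `k * n ^ 3 + 1` clients into `k`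
    -- sites.
    cost≥1 : 1 ≤ hubCost ℕ.+ sum travel
    cost≥1 = ℕP.n≢0⇒n>0 λ eq → ℕP.<-irrefl refl (begin-strict
      k ℕ.* n ^ 3     <⟨ total-served ⟩
      n ^ 3 ℕ.* k ℕ.+ clients ℕ.* hubCost ℕ.+ sum travel
        ≡⟨ cong₂ (λ s t → n ^ 3 ℕ.* k ℕ.+ clients ℕ.* s ℕ.+ t)
             (ℕP.m+n≡0⇒m≡0 hubCost eq) (ℕP.m+n≡0⇒n≡0 hubCost eq) ⟩
      n ^ 3 ℕ.* k ℕ.+ clients ℕ.* 0 ℕ.+ 0
        ≡⟨ trans (ℕP.+-identityʳ _) (trans (cong (n ^ 3 ℕ.* k ℕ.+_) (ℕP.*-zeroʳ clients)) (ℕP.+-identityʳ _)) ⟩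
      n ^ 3 ℕ.* k     ≡⟨ ℕP.*-comm (n ^ 3) k ⟩
      k ℕ.* n ^ 3 ∎)
      where open ℕP.≤-Reasoning

  -- Openings other than that of the hub are free, so all other facilities stay open in every
  -- scenario.
  isOpen : Fin k → Facility n → Bool
  isOpen zero    i = true
  isOpen (suc τ) i = not (isHub i)

  -- Feasible because distinct slots bound the loads and the hub is a target only for `τ = zero`,
  -- when it is open.
  mixedSolution : (r : Fin k) (φ ψ : Choice) → φ r ≢ ψ r → Fin k → Fin K → Solution a n
  mixedSolution r φ ψ φ≢ψ τ ρ = record
    { y        = λ i → bit (isOpen τ i)
    ; x        = λ i j → bit (does (A j ≟ i))
    ; assigned = λ j → sum-indicator (A j)
    ; onlyOpen = λ i j → open-target i j
    ; capacity = λ i → subst (sum (λ j → bitℕ (does (A j ≟ i))) ≤_) capacity-eq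
        (load-bound A (λ j → slot (kind j) τ) distinct i)
    }
    where
    A : Client a n → Facility n
    A j = facility (mixed r (kind j) τ ρ φ ψ)
    distinct : ∀ j j′ → A j ≡ A j′ → slot (kind j) τ ≡ slot (kind j′) τ → j ≡ j′
    distinct j j′ eq eqₛ = kind-injective
      (mixed-slot-injective r ρ φ ψ φ≢ψ τ (kind j) (kind j′) (facility-injective eq) eqₛ)
    not-hub : ∀ κ τ → mixed r κ (suc τ) ρ φ ψ ≢ hub
    not-hub (base p zero)    τ ()
    not-hub (base p (suc b)) τ ()
    not-hub (float u v)      τ ()
    not-hub (far t s)        τ ()
    open-target : ∀ i j → toℕ (bit (does (A j ≟ i))) ≤ toℕ (bit (isOpen τ i))
    open-target i j with A j ≟ i
    ... | no _ = z≤n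
    ... | yes refl = go τ refl
      where
      go : ∀ σ → σ ≡ τ → 1 ≤ toℕ (bit (isOpen σ (A j)))
      go zero    _ = s≤s z≤n
      go (suc σ) refl with facility hub ≟ A j
      ... | yes e = contradiction (sym (facility-injective e)) (not-hub (kind j) σ)
      ... | no _ = s≤s z≤n

-- Inequalities between Cauchy reals

natℚ-+ : ∀ m n → natℚ (m ℕ.+ n) ≡ natℚ m ℚ.+ natℚ n
natℚ-+ m n = ℚP.toℚᵘ-injective (begin
  toℚᵘ (fromℚᵘ (u (m ℕ.+ n)))     ≈⟨ ℚP.toℚᵘ-fromℚᵘ (u (m ℕ.+ n)) ⟩
  u (m ℕ.+ n)
    ≡⟨ cong (λ z → mkℚᵘ z 0) (sym (cong₂ ℤ._+_ (ℤP.*-identityʳ (+ m)) (ℤP.*-identityʳ (+ n)))) ⟩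
  u m ℚᵘ.+ u n                    ≈⟨ ℚᵘP.+-cong (ℚP.toℚᵘ-fromℚᵘ (u m)) (ℚP.toℚᵘ-fromℚᵘ (u n)) ⟨
  toℚᵘ (natℚ m) ℚᵘ.+ toℚᵘ (natℚ n) ≈⟨ ℚP.toℚᵘ-homo-+ (natℚ m) (natℚ n) ⟨
  toℚᵘ (natℚ m ℚ.+ natℚ n)        ∎)
  where
  open ℚᵘP.≃-Reasoning
  u : ℕ → ℚᵘ
  u k = mkℚᵘ (+ k) 0

natℚ-* : ∀ m n → natℚ (m ℕ.* n) ≡ natℚ m ℚ.* natℚ n
natℚ-* zero    n = sym (ℚP.*-zeroˡ (natℚ n))
natℚ-* (suc m) n = begin
  natℚ (n ℕ.+ m ℕ.* n)                ≡⟨ natℚ-+ n (m ℕ.* n) ⟩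
  natℚ n ℚ.+ natℚ (m ℕ.* n)           ≡⟨ cong₂ ℚ._+_ (sym (ℚP.*-identityˡ (natℚ n))) (natℚ-* m n) ⟩
  1ℚ ℚ.* natℚ n ℚ.+ natℚ m ℚ.* natℚ n ≡⟨ ℚP.*-distribʳ-+ (natℚ n) 1ℚ (natℚ m) ⟨
  (1ℚ ℚ.+ natℚ m) ℚ.* natℚ n          ≡⟨ cong (ℚ._* natℚ n) (natℚ-+ 1 m) ⟨
  natℚ (suc m) ℚ.* natℚ n             ∎
  where open ≡-Reasoning

0≤natℚ : ∀ m → 0ℚ ℚ.≤ natℚ m
0≤natℚ zero    = ℚP.≤-refl
0≤natℚ (suc m) = subst (0ℚ ℚ.≤_) (sym (natℚ-+ 1 m)) (ℚP.+-mono-≤ (ℚP.<⇒≤ 0<1) (0≤natℚ m))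

natℚ-mono : ∀ {m n} → m ℕ.≤ n → natℚ m ℚ.≤ natℚ n
natℚ-mono {m} {n} m≤n = begin
  natℚ m                       ≡⟨ ℚP.+-identityʳ (natℚ m) ⟨
  natℚ m ℚ.+ 0ℚ                ≤⟨ ℚP.+-monoʳ-≤ (natℚ m) (0≤natℚ (n ℕ.∸ m)) ⟩
  natℚ m ℚ.+ natℚ (n ℕ.∸ m)    ≡⟨ natℚ-+ m (n ℕ.∸ m) ⟨
  natℚ (m ℕ.+ (n ℕ.∸ m))       ≡⟨ cong natℚ (ℕP.m+[n∸m]≡n m≤n) ⟩
  natℚ n                       ∎
  where open ℚP.≤-Reasoning

natℚ-sum : ∀ {N} (f : Fin N → ℕ) → natℚ (sum f) ≡ sumℚ (λ i → natℚ (f i))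
natℚ-sum {zero}  f = refl
natℚ-sum {suc N} f = trans (natℚ-+ (f zero) _) (cong (natℚ (f zero) ℚ.+_) (natℚ-sum (λ i → f (suc i))))

sumℚ-const : ∀ N x → sumℚ {N} (λ _ → x) ≡ natℚ N ℚ.* x
sumℚ-const N x = sym (begin
  natℚ N ℚ.* x                        ≡⟨ cong (λ m → natℚ m ℚ.* x) (trans (sum-const N 1) (ℕP.*-identityʳ N)) ⟨
  natℚ (sum {N} (λ _ → 1)) ℚ.* x      ≡⟨ cong (ℚ._* x) (natℚ-sum {N} (λ _ → 1)) ⟩
  sumℚ {N} (λ _ → 1ℚ) ℚ.* x           ≡⟨ Σℚ.*-distribʳ-sum {N} x (λ _ → 1ℚ) ⟩
  sumℚ {N} (λ _ → 1ℚ ℚ.* x)           ≡⟨ Σℚ.sum-cong-≗ {N} (λ _ → ℚP.*-identityˡ x) ⟩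
  sumℚ {N} (λ _ → x)                  ∎)
  where open ≡-Reasoning

≤+pos : ∀ x {ε} → 0ℚ ℚ.< ε → x ℚ.≤ x ℚ.+ ε
≤+pos x 0<ε = ℚP.≤-trans (ℚP.≤-reflexive (sym (ℚP.+-identityʳ x))) (ℚP.+-monoʳ-≤ x (ℚP.<⇒≤ 0<ε))

pointwise-≤ : ∀ x y → (∀ i → seq x i ℚ.≤ seq y i) → x ≤ᵣ y
pointwise-≤ x y x≤y ε 0<ε = 0 , λ i _ → ℚP.≤-trans (x≤y i) (≤+pos (seq y i) 0<ε)

pointwise-≡ : ∀ x y → (∀ i → seq x i ≡ seq y i) → x ≤ᵣ y
pointwise-≡ x y eq = pointwise-≤ x y (λ i → ℚP.≤-reflexive (eq i))

≤ᵣ-trans : ∀ x y z → x ≤ᵣ y → y ≤ᵣ z → x ≤ᵣ z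
≤ᵣ-trans x y z x≤y y≤z ε 0<ε with half ε 0<ε
... | δ , 0<δ , refl with x≤y δ 0<δ | y≤z δ 0<δ
... | M , p | N , q = M ℕ.⊔ N , λ i hi → begin
  seq x i                     ≤⟨ p i (ℕP.m⊔n≤o⇒m≤o M N hi) ⟩
  seq y i ℚ.+ δ               ≤⟨ ℚP.+-monoˡ-≤ δ (q i (ℕP.m⊔n≤o⇒n≤o M N hi)) ⟩
  seq z i ℚ.+ δ ℚ.+ δ         ≡⟨ ℚP.+-assoc (seq z i) δ δ ⟩
  seq z i ℚ.+ (δ ℚ.+ δ)       ∎
  where open ℚP.≤-Reasoning

+ᵣ-mono : ∀ x x′ y y′ → x ≤ᵣ x′ → y ≤ᵣ y′ → x +ᵣ y ≤ᵣ x′ +ᵣ y′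
+ᵣ-mono x x′ y y′ x≤ y≤ ε 0<ε with half ε 0<ε
... | δ , 0<δ , refl with x≤ δ 0<δ | y≤ δ 0<δ
... | M , p | N , q = M ℕ.⊔ N , λ i hi → begin
  seq x i ℚ.+ seq y i
    ≤⟨ ℚP.+-mono-≤ (p i (ℕP.m⊔n≤o⇒m≤o M N hi)) (q i (ℕP.m⊔n≤o⇒n≤o M N hi)) ⟩
  (seq x′ i ℚ.+ δ) ℚ.+ (seq y′ i ℚ.+ δ)
    ≡⟨ solve 3 (λ a b d → (a :+ d) :+ (b :+ d) := (a :+ b) :+ (d :+ d)) refl (seq x′ i) (seq y′ i) δ ⟩
  seq x′ i ℚ.+ seq y′ i ℚ.+ (δ ℚ.+ δ) ∎
  where
  open ℚP.≤-Reasoning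
  open +-*-Solver

∑-mono : ∀ {N} (f g : Fin N → ℝ) → (∀ i → f i ≤ᵣ g i) → ∑ f ≤ᵣ ∑ g
∑-mono {zero}  f g f≤g = pointwise-≡ 0ᵣ 0ᵣ (λ _ → refl)
∑-mono {suc N} f g f≤g = +ᵣ-mono (f zero) (g zero) (∑ (λ i → f (suc i))) (∑ (λ i → g (suc i)))
  (f≤g zero) (∑-mono (λ i → f (suc i)) (λ i → g (suc i)) (λ i → f≤g (suc i)))

seq-∑ : ∀ {N} (f : Fin N → ℝ) i → seq (∑ f) i ≡ sumℚ (λ s → seq (f s) i)
seq-∑ {zero}  f i = refl
seq-∑ {suc N} f i = cong (seq (f zero) i ℚ.+_) (seq-∑ (λ s → f (suc s)) i)

fromℚ-cancel-≤ : ∀ p q → fromℚ p ≤ᵣ fromℚ q → p ℚ.≤ q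
fromℚ-cancel-≤ p q p≤q = ℚP.≮⇒≥ λ q<p →
  let 0<d : 0ℚ ℚ.< p ℚ.- q
      0<d = subst (ℚ._< p ℚ.- q) (ℚP.+-inverseʳ q) (ℚP.+-monoˡ-< (ℚ.- q) q<p)
      δ , 0<δ , δ+δ = half (p ℚ.- q) 0<d
      N , le = p≤q δ 0<δ
  in ℚP.<-irrefl refl (begin-strict
    q ℚ.+ δ                ≡⟨ ℚP.+-identityʳ _ ⟨
    q ℚ.+ δ ℚ.+ 0ℚ         <⟨ ℚP.+-monoʳ-< (q ℚ.+ δ) 0<δ ⟩
    q ℚ.+ δ ℚ.+ δ          ≡⟨ trans (ℚP.+-assoc q δ δ) (cong (q ℚ.+_) δ+δ) ⟩
    q ℚ.+ (p ℚ.- q)        ≡⟨ solve 2 (λ p q → q :+ (p :- q) := p) refl p q ⟩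
    p                      ≤⟨ le N ℕP.≤-refl ⟩
    q ℚ.+ δ                ∎)
  where
  open ℚP.≤-Reasoning
  open +-*-Solver

-- The bound by 1 is for `≤*-estimate`, where it discards the term `δ - 1`.
small : ∀ ε K → 0ℚ ℚ.< ε → 0ℚ ℚ.< K → Σ[ δ ∈ ℚ ] 0ℚ ℚ.< δ × δ ℚ.≤ 1ℚ × K ℚ.* δ ℚ.≤ ε
small ε K 0<ε 0<K with divide ε K 0<ε 0<K
... | δ , 0<δ , Kδ with ℚP.≤-total δ 1ℚ
... | inj₁ δ≤1 = δ , 0<δ , δ≤1 , ℚP.≤-reflexive Kδ
... | inj₂ 1≤δ = 1ℚ , 0<1 , ℚP.≤-refl , ℚP.≤-trans
  (ℚP.*-monoˡ-≤-nonNeg K {{ℚ.nonNegative (ℚP.<⇒≤ 0<K)}} 1≤δ) (ℚP.≤-reflexive Kδ)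

0<1+ : ∀ {q} → 0ℚ ℚ.≤ q → 0ℚ ℚ.< 1ℚ ℚ.+ q
0<1+ {q} 0≤q = ℚP.+-mono-<-≤ {0ℚ} {1ℚ} {0ℚ} {q} 0<1 0≤q

≤1+ : ∀ q → q ℚ.≤ 1ℚ ℚ.+ q
≤1+ q = ℚP.≤-trans (ℚP.≤-reflexive (sym (ℚP.+-identityˡ q))) (ℚP.+-monoˡ-≤ q {0ℚ} {1ℚ} (ℚP.<⇒≤ 0<1))

fromℚ-*-mono : ∀ q x y → 0ℚ ℚ.≤ q → x ≤ᵣ y → fromℚ q *ᵣ x ≤ᵣ fromℚ q *ᵣ y
fromℚ-*-mono q x y 0≤q x≤y ε 0<ε =
  -- Division is by `1 + q`, as `q` may be zero.
  let δ , 0<δ , _ , bound = small ε (1ℚ ℚ.+ q) 0<ε (0<1+ 0≤q)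
      N , p = x≤y δ 0<δ
  in N , λ i hi → estimate (seq x i) (seq y i) δ 0<δ bound (p i hi)
  where
  estimate : ∀ s t δ → 0ℚ ℚ.< δ → (1ℚ ℚ.+ q) ℚ.* δ ℚ.≤ ε → s ℚ.≤ t ℚ.+ δ → q ℚ.* s ℚ.≤ q ℚ.* t ℚ.+ ε
  estimate s t δ 0<δ bound s≤ = begin
    q ℚ.* s                   ≤⟨ ℚP.*-monoˡ-≤-nonNeg q {{ℚ.nonNegative 0≤q}} s≤ ⟩
    q ℚ.* (t ℚ.+ δ)           ≡⟨ ℚP.*-distribˡ-+ q t δ ⟩
    q ℚ.* t ℚ.+ q ℚ.* δ
      ≤⟨ ℚP.+-monoʳ-≤ (q ℚ.* t) (ℚP.*-monoʳ-≤-nonNeg δ {{ℚ.nonNegative (ℚP.<⇒≤ 0<δ)}} (≤1+ q)) ⟩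
    q ℚ.* t ℚ.+ (1ℚ ℚ.+ q) ℚ.* δ ≤⟨ ℚP.+-monoʳ-≤ (q ℚ.* t) bound ⟩
    q ℚ.* t ℚ.+ ε             ∎
    where open ℚP.≤-Reasoning

-- Expanding (t + δ)(x − 1 + δ) ≥ 0.
≤*-estimate : ∀ t x B C δ → 0ℚ ℚ.≤ t ℚ.+ δ → 1ℚ ℚ.≤ x ℚ.+ δ → 0ℚ ℚ.≤ δ → δ ℚ.≤ 1ℚ → t ℚ.≤ B → x ℚ.≤ C →
  t ℚ.≤ t ℚ.* x ℚ.+ (B ℚ.+ C) ℚ.* δ
≤*-estimate t x B C δ 0≤t+δ 1≤x+δ 0≤δ δ≤1 t≤B x≤C = begin
  t                                               ≡⟨ ℚP.+-identityʳ t ⟨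
  t ℚ.+ 0ℚ                                        ≤⟨ ℚP.+-monoʳ-≤ t product≥0 ⟩
  t ℚ.+ (t ℚ.+ δ) ℚ.* (x ℚ.+ δ ℚ.- 1ℚ)
    ≡⟨ solve 4 (λ t x δ i → t :+ (t :+ δ) :* (x :+ δ :- i) :=
         t :* x :+ (t :- t :* i) :+ (t :+ x :+ (δ :- i)) :* δ) refl t x δ 1ℚ ⟩
  t ℚ.* x ℚ.+ (t ℚ.- t ℚ.* 1ℚ) ℚ.+ (t ℚ.+ x ℚ.+ (δ ℚ.- 1ℚ)) ℚ.* δ
    ≡⟨ cong (λ s → t ℚ.* x ℚ.+ s ℚ.+ (t ℚ.+ x ℚ.+ (δ ℚ.- 1ℚ)) ℚ.* δ)
         (trans (cong (λ s → t ℚ.- s) (ℚP.*-identityʳ t)) (ℚP.+-inverseʳ t)) ⟩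
  t ℚ.* x ℚ.+ 0ℚ ℚ.+ (t ℚ.+ x ℚ.+ (δ ℚ.- 1ℚ)) ℚ.* δ
    ≡⟨ cong (ℚ._+ (t ℚ.+ x ℚ.+ (δ ℚ.- 1ℚ)) ℚ.* δ) (ℚP.+-identityʳ (t ℚ.* x)) ⟩
  t ℚ.* x ℚ.+ (t ℚ.+ x ℚ.+ (δ ℚ.- 1ℚ)) ℚ.* δ
    ≤⟨ ℚP.+-monoʳ-≤ (t ℚ.* x) (ℚP.*-monoʳ-≤-nonNeg δ {{ℚ.nonNegative 0≤δ}}
         (ℚP.+-mono-≤ (ℚP.+-mono-≤ t≤B x≤C) (ℚP.≤-trans (ℚP.+-monoˡ-≤ (ℚ.- 1ℚ) δ≤1) ℚP.≤-refl))) ⟩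
  t ℚ.* x ℚ.+ (B ℚ.+ C ℚ.+ 0ℚ) ℚ.* δ
    ≡⟨ cong (λ s → t ℚ.* x ℚ.+ s ℚ.* δ) (ℚP.+-identityʳ (B ℚ.+ C)) ⟩
  t ℚ.* x ℚ.+ (B ℚ.+ C) ℚ.* δ                     ∎
  where
  open ℚP.≤-Reasoning
  open +-*-Solver
  product≥0 : 0ℚ ℚ.≤ (t ℚ.+ δ) ℚ.* (x ℚ.+ δ ℚ.- 1ℚ)
  product≥0 = ℚP.≤-trans (ℚP.≤-reflexive (sym (ℚP.*-zeroʳ (t ℚ.+ δ))))
    (ℚP.*-monoˡ-≤-nonNeg (t ℚ.+ δ) {{ℚ.nonNegative 0≤t+δ}}
      (ℚP.≤-trans (ℚP.≤-reflexive (sym (ℚP.+-inverseʳ 1ℚ))) (ℚP.+-monoˡ-≤ (ℚ.- 1ℚ) 1≤x+δ)))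

x≤∣x∣ : ∀ x → x ℚ.≤ ℚ.∣ x ∣
x≤∣x∣ x with ℚP.≤-total 0ℚ x
... | inj₁ 0≤x = ℚP.≤-reflexive (sym (ℚP.0≤p⇒∣p∣≡p 0≤x))
... | inj₂ x≤0 = ℚP.≤-trans x≤0 (ℚP.0≤∣p∣ x)

t≤t*x : ∀ t x → 0ᵣ ≤ᵣ t → 1ᵣ ≤ᵣ x → t ≤ᵣ t *ᵣ x
t≤t*x t x 0≤t 1≤x ε 0<ε =
  let B , 0<B , Nt , bt = eventually-bounded t
      C , 0<C , Nx , bx = eventually-bounded x
      δ , 0<δ , δ≤1 , bound = small ε (B ℚ.+ C) 0<ε (ℚP.+-mono-< 0<B 0<C)
      Mt , p = 0≤t δ 0<δ
      Mx , q = 1≤x δ 0<δ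
      L : ∀ {i} → (Nt ℕ.⊔ Nx) ℕ.⊔ (Mt ℕ.⊔ Mx) ℕ.≤ i → Nt ℕ.⊔ Nx ℕ.≤ i
      L = ℕP.m⊔n≤o⇒m≤o (Nt ℕ.⊔ Nx) (Mt ℕ.⊔ Mx)
      R : ∀ {i} → (Nt ℕ.⊔ Nx) ℕ.⊔ (Mt ℕ.⊔ Mx) ℕ.≤ i → Mt ℕ.⊔ Mx ℕ.≤ i
      R = ℕP.m⊔n≤o⇒n≤o (Nt ℕ.⊔ Nx) (Mt ℕ.⊔ Mx)
  in (Nt ℕ.⊔ Nx) ℕ.⊔ (Mt ℕ.⊔ Mx) , λ i hi → ℚP.≤-trans
    (≤*-estimate (seq t i) (seq x i) B C δ
      (p i (ℕP.m⊔n≤o⇒m≤o Mt Mx (R hi))) (q i (ℕP.m⊔n≤o⇒n≤o Mt Mx (R hi))) (ℚP.<⇒≤ 0<δ) δ≤1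
      (ℚP.≤-trans (x≤∣x∣ (seq t i)) (bt i (ℕP.m⊔n≤o⇒m≤o Nt Nx (L hi))))
      (ℚP.≤-trans (x≤∣x∣ (seq x i)) (bx i (ℕP.m⊔n≤o⇒n≤o Nt Nx (L hi)))))
    (ℚP.+-monoʳ-≤ (seq t i ℚ.* seq x i) bound)

close-≤ : ∀ x y ε → ℚ.∣ x ℚ.- y ∣ ℚ.≤ ε → x ℚ.≤ y ℚ.+ ε
close-≤ x y ε h = begin
  x                 ≡⟨ solve 2 (λ x y → x := y :+ (x :- y)) refl x y ⟩
  y ℚ.+ (x ℚ.- y)   ≤⟨ ℚP.+-monoʳ-≤ y (ℚP.≤-trans (x≤∣x∣ (x ℚ.- y)) h) ⟩
  y ℚ.+ ε           ∎
  where
  open ℚP.≤-Reasoning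
  open +-*-Solver

-- A substitute for totality, which is not decidable on Cauchy reals. The rationals at one late
-- index `I` are compared with tolerance `2η`, where `η = ε/4`: one outcome gives the bound for `ε`,
-- the other gives `x ≤ y` against the assumption.
≰ᵣ⇒≥ᵣ : ∀ x y → ¬ x ≤ᵣ y → y ≤ᵣ x
≰ᵣ⇒≥ᵣ x y x≰y ε 0<ε =
  let δ , 0<δ , δ+δ = half ε 0<ε
      η , 0<η , η+η = half δ 0<δ
      M , p = cauchy x η 0<η
      N , q = cauchy y η 0<η
      I = M ℕ.⊔ N
      near-x : ∀ i j → I ℕ.≤ i → I ℕ.≤ j → seq x i ℚ.≤ seq x j ℚ.+ η
      near-x i j hi hj = close-≤ _ _ η (p i j (ℕP.m⊔n≤o⇒m≤o M N hi) (ℕP.m⊔n≤o⇒m≤o M N hj))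
      near-y : ∀ i j → I ℕ.≤ i → I ℕ.≤ j → seq y i ℚ.≤ seq y j ℚ.+ η
      near-y i j hi hj = close-≤ _ _ η (q i j (ℕP.m⊔n≤o⇒n≤o M N hi) (ℕP.m⊔n≤o⇒n≤o M N hj))
  in decide η I (trans (cong₂ ℚ._+_ η+η η+η) δ+δ) near-x near-y (seq y I ℚP.≤? seq x I ℚ.+ (η ℚ.+ η))
  where
  above : ∀ xi xI yi yI η → yi ℚ.≤ yI ℚ.+ η → yI ℚ.≤ xI ℚ.+ (η ℚ.+ η) → xI ℚ.≤ xi ℚ.+ η →
    yi ℚ.≤ xi ℚ.+ (η ℚ.+ η ℚ.+ (η ℚ.+ η))
  above xi xI yi yI η p q r = begin
    yi                              ≤⟨ p ⟩
    yI ℚ.+ η                        ≤⟨ ℚP.+-monoˡ-≤ η q ⟩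
    xI ℚ.+ (η ℚ.+ η) ℚ.+ η          ≤⟨ ℚP.+-monoˡ-≤ η (ℚP.+-monoˡ-≤ (η ℚ.+ η) r) ⟩
    xi ℚ.+ η ℚ.+ (η ℚ.+ η) ℚ.+ η
      ≡⟨ solve 2 (λ x η → x :+ η :+ (η :+ η) :+ η := x :+ ((η :+ η) :+ (η :+ η))) refl xi η ⟩
    xi ℚ.+ (η ℚ.+ η ℚ.+ (η ℚ.+ η))  ∎
    where
    open ℚP.≤-Reasoning
    open +-*-Solver
  below : ∀ xi xI yi yI η → xi ℚ.≤ xI ℚ.+ η → xI ℚ.+ (η ℚ.+ η) ℚ.≤ yI → yI ℚ.≤ yi ℚ.+ η → xi ℚ.≤ yi
  below xi xI yi yI η p q r = begin
    xi                              ≤⟨ p ⟩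
    xI ℚ.+ η                        ≡⟨ solve 2 (λ x η → x :+ η := x :+ (η :+ η) :- η) refl xI η ⟩
    xI ℚ.+ (η ℚ.+ η) ℚ.- η          ≤⟨ ℚP.+-monoˡ-≤ (ℚ.- η) q ⟩
    yI ℚ.- η                        ≤⟨ ℚP.+-monoˡ-≤ (ℚ.- η) r ⟩
    yi ℚ.+ η ℚ.- η                  ≡⟨ solve 2 (λ y η → y :+ η :- η := y) refl yi η ⟩
    yi                              ∎
    where
    open ℚP.≤-Reasoning
    open +-*-Solver
  decide : ∀ η I → η ℚ.+ η ℚ.+ (η ℚ.+ η) ≡ ε →
    (∀ i j → I ℕ.≤ i → I ℕ.≤ j → seq x i ℚ.≤ seq x j ℚ.+ η) →
    (∀ i j → I ℕ.≤ i → I ℕ.≤ j → seq y i ℚ.≤ seq y j ℚ.+ η) →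
    Dec (seq y I ℚ.≤ seq x I ℚ.+ (η ℚ.+ η)) →
    Σ[ N ∈ ℕ ] (∀ i → N ℕ.≤ i → seq y i ℚ.≤ seq x i ℚ.+ ε)
  decide η I sum-η near-x near-y (yes y≤x) = I , λ i hi →
    subst (λ e → seq y i ℚ.≤ seq x i ℚ.+ e) sum-η
      (above (seq x i) (seq x I) (seq y i) (seq y I) η (near-y i I hi ℕP.≤-refl) y≤x (near-x I i ℕP.≤-refl hi))
  decide η I sum-η near-x near-y (no y≰x) = contradiction
    (λ ε′ 0<ε′ → I , λ i hi → ℚP.≤-trans
      (below (seq x i) (seq x I) (seq y i) (seq y I) η
        (near-x i I hi ℕP.≤-refl) (ℚP.<⇒≤ (ℚP.≰⇒> y≰x)) (near-y I i ℕP.≤-refl hi))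
      (≤+pos (seq y i) 0<ε′))
    x≰y

-- If `y` violates the bound, then `b ≤ y`, and subtracting this from the sum leaves `x ≤ b`. This
-- is what forbids one inequality to cut off two points with a feasible midpoint.
+≤+⇒not-both-≰ : ∀ x y b → x +ᵣ y ≤ᵣ b +ᵣ b → ¬ x ≤ᵣ b → ¬ y ≤ᵣ b → ⊥
+≤+⇒not-both-≰ x y b x+y≤b+b x≰b y≰b = x≰b λ ε 0<ε →
  let δ , 0<δ , δ+δ = half ε 0<ε
      M , p = x+y≤b+b δ 0<δ
      N , q = ≰ᵣ⇒≥ᵣ y b y≰b δ 0<δ
  in M ℕ.⊔ N , λ i hi → subst (λ e → seq x i ℚ.≤ seq b i ℚ.+ e) δ+δ
    (estimate (seq x i) (seq y i) (seq b i) δ (p i (ℕP.m⊔n≤o⇒m≤o M N hi)) (q i (ℕP.m⊔n≤o⇒n≤o M N hi)))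
  where
  estimate : ∀ x y b δ → x ℚ.+ y ℚ.≤ b ℚ.+ b ℚ.+ δ → b ℚ.≤ y ℚ.+ δ → x ℚ.≤ b ℚ.+ (δ ℚ.+ δ)
  estimate x y b δ p q = begin
    x                                 ≡⟨ solve 2 (λ x y → x := x :+ y :- y) refl x y ⟩
    x ℚ.+ y ℚ.- y                     ≤⟨ ℚP.+-monoˡ-≤ (ℚ.- y) p ⟩
    b ℚ.+ b ℚ.+ δ ℚ.- y
      ≡⟨ solve 3 (λ b y δ → b :+ b :+ δ :- y := b :+ (b :+ (δ :- y))) refl b y δ ⟩
    b ℚ.+ (b ℚ.+ (δ ℚ.- y))           ≤⟨ ℚP.+-monoʳ-≤ b (ℚP.+-monoˡ-≤ (δ ℚ.- y) q) ⟩
    b ℚ.+ (y ℚ.+ δ ℚ.+ (δ ℚ.- y))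
      ≡⟨ solve 3 (λ b y δ → b :+ (y :+ δ :+ (δ :- y)) := b :+ (δ :+ δ)) refl b y δ ⟩
    b ℚ.+ (δ ℚ.+ δ)                   ∎
    where
    open ℚP.≤-Reasoning
    open +-*-Solver

eventually-all : ∀ {N} (Q : Fin N → ℕ → Set) → (∀ s → Σ[ M ∈ ℕ ] (∀ i → M ℕ.≤ i → Q s i)) →
  Σ[ M ∈ ℕ ] (∀ i → M ℕ.≤ i → ∀ s → Q s i)
eventually-all {zero}  Q ev = 0 , λ i _ ()
eventually-all {suc N} Q ev with ev zero | eventually-all (λ s → Q (suc s)) (λ s → ev (suc s))
... | M , p | M′ , p′ = M ℕ.⊔ M′ , λ
  { i hi zero    → p i (ℕP.m⊔n≤o⇒m≤o M M′ hi)
  ; i hi (suc s) → p′ i (ℕP.m⊔n≤o⇒n≤o M M′ hi) s }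

-- The absolute value of the numerator serves, as denominators are at least 1.
natℚ-ceiling : ∀ q → Σ[ G ∈ ℕ ] q ℚ.≤ natℚ G
natℚ-ceiling q = ceiling q , ℚP.toℚᵘ-cancel-≤ {q} {natℚ (ceiling q)}
  (ℚᵘP.≤-respʳ-≃ (ℚᵘP.≃-sym (ℚP.toℚᵘ-fromℚᵘ (mkℚᵘ (+ ceiling q) 0))) (toℚᵘ≤ q))
  where
  ceiling : ℚ → ℕ
  ceiling q = ℤ.∣ ℚ.↥ q ∣
  toℚᵘ≤ : ∀ q → toℚᵘ q ℚᵘ.≤ mkℚᵘ (+ ceiling q) 0
  toℚᵘ≤ (ℚ.mkℚ (+ m) d _) = ℚᵘ.*≤* (subst₂ ℤ._≤_ (ℤP.pos-* m 1) (ℤP.pos-* m (suc d))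
    (ℤ.+≤+ (ℕP.*-monoʳ-≤ m (ℕ.s≤s ℕ.z≤n))))
  toℚᵘ≤ (ℚ.mkℚ ℤ.-[1+ m ] d _) = ℚᵘ.*≤* ℤ.-≤+

natural-upper-bound : ∀ x → Σ[ G ∈ ℕ ] x ≤ᵣ fromℕ G
natural-upper-bound x =
  let B , 0<B , N , bound = eventually-bounded x
      G , B≤G = natℚ-ceiling B
  in G , λ ε 0<ε → N , λ i hi → ℚP.≤-trans (x≤∣x∣ (seq x i))
    (ℚP.≤-trans (bound i hi) (ℚP.≤-trans B≤G (≤+pos (natℚ G) 0<ε)))

-- Linear functionals and relaxations

sum²-+ : ∀ {M N} (f g : Fin M → Fin N → ℚ) →
  sumℚ (λ τ → sumℚ (λ ρ → f τ ρ ℚ.+ g τ ρ)) ≡ sumℚ (λ τ → sumℚ (f τ)) ℚ.+ sumℚ (λ τ → sumℚ (g τ))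
sum²-+ f g = trans (Σℚ.sum-cong-≗ (λ τ → Σℚ.∑-distrib-+ (f τ) (g τ)))
  (Σℚ.∑-distrib-+ (λ τ → sumℚ (f τ)) (λ τ → sumℚ (g τ)))

sum²-* : ∀ {M N} x (f : Fin M → Fin N → ℚ) →
  x ℚ.* sumℚ (λ τ → sumℚ (f τ)) ≡ sumℚ (λ τ → sumℚ (λ ρ → x ℚ.* f τ ρ))
sum²-* x f = trans (Σℚ.*-distribˡ-sum x (λ τ → sumℚ (f τ)))
  (Σℚ.sum-cong-≗ (λ τ → Σℚ.*-distribˡ-sum x (f τ)))

sum²-comm : ∀ {L M N} (f : Fin L → Fin M → Fin N → ℚ) →
  sumℚ (λ i → sumℚ (λ τ → sumℚ (f i τ))) ≡ sumℚ (λ τ → sumℚ (λ ρ → sumℚ (λ i → f i τ ρ)))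
sum²-comm f = trans (Σℚ.∑-comm (λ i τ → sumℚ (f i τ)))
  (Σℚ.sum-cong-≗ (λ τ → Σℚ.∑-comm (λ i ρ → f i τ ρ)))

sum²-cong : ∀ {M N} {f g : Fin M → Fin N → ℚ} → (∀ τ ρ → f τ ρ ≡ g τ ρ) →
  sumℚ (λ τ → sumℚ (f τ)) ≡ sumℚ (λ τ → sumℚ (g τ))
sum²-cong f≡g = Σℚ.sum-cong-≗ (λ τ → Σℚ.sum-cong-≗ (f≡g τ))

module _ {M N : ℕ} (c : ℚ) where

  average : (Fin M → Fin N → ℚ) → ℚ
  average f = c ℚ.* sumℚ (λ τ → sumℚ (f τ))

  average-cong : ∀ {f g} → (∀ τ ρ → f τ ρ ≡ g τ ρ) → average f ≡ average g
  average-cong f≡g = cong (c ℚ.*_) (sum²-cong f≡g)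

  average-+ : ∀ f g → average (λ τ ρ → f τ ρ ℚ.+ g τ ρ) ≡ average f ℚ.+ average g
  average-+ f g = trans (cong (c ℚ.*_) (sum²-+ f g)) (ℚP.*-distribˡ-+ c _ _)

  average-mono : 0ℚ ℚ.≤ c → ∀ {f g} → (∀ τ ρ → f τ ρ ℚ.≤ g τ ρ) → average f ℚ.≤ average g
  average-mono 0≤c f≤g = ℚP.*-monoˡ-≤-nonNeg c {{ℚ.nonNegative 0≤c}}
    (sumℚ-mono (λ τ → sumℚ-mono (f≤g τ)))

  average-sum : ∀ {L} (f : Fin L → Fin M → Fin N → ℚ) →
    sumℚ (λ i → average (f i)) ≡ average (λ τ ρ → sumℚ (λ i → f i τ ρ))
  average-sum f = trans (sym (Σℚ.*-distribˡ-sum c (λ i → sumℚ (λ τ → sumℚ (f i τ)))))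
    (cong (c ℚ.*_) (sum²-comm f))

  average-* : ∀ x f → x ℚ.* average f ≡ average (λ τ ρ → x ℚ.* f τ ρ)
  average-* x f = begin
    x ℚ.* (c ℚ.* S)   ≡⟨ solve 3 (λ x c s → x :* (c :* s) := c :* (x :* s)) refl x c S ⟩
    c ℚ.* (x ℚ.* S)   ≡⟨ cong (c ℚ.*_) (sum²-* x f) ⟩
    average (λ τ ρ → x ℚ.* f τ ρ) ∎
    where
    open ≡-Reasoning
    open +-*-Solver
    S : ℚ
    S = sumℚ (λ τ → sumℚ (f τ))

  average-const : ∀ x → c ℚ.* (natℚ M ℚ.* natℚ N) ≡ 1ℚ → average (λ τ ρ → x) ≡ x
  average-const x unit = begin
    c ℚ.* sumℚ {M} (λ τ → sumℚ {N} (λ ρ → x))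
      ≡⟨ cong (c ℚ.*_) (trans (Σℚ.sum-cong-≗ {M} (λ τ → sumℚ-const N x)) (sumℚ-const M (natℚ N ℚ.* x))) ⟩
    c ℚ.* (natℚ M ℚ.* (natℚ N ℚ.* x))
      ≡⟨ solve 4 (λ c m n x → c :* (m :* (n :* x)) := c :* (m :* n) :* x) refl c (natℚ M) (natℚ N) x ⟩
    c ℚ.* (natℚ M ℚ.* natℚ N) ℚ.* x
      ≡⟨ trans (cong (ℚ._* x) unit) (ℚP.*-identityˡ x) ⟩
    x ∎
    where
    open ≡-Reasoning
    open +-*-Solver

module _ {F C : ℕ} where

  dot : (Fin F → ℚ) → (Fin F → Fin C → ℚ) → (Fin F → ℚ) → (Fin F → Fin C → ℚ) → ℚ
  dot f c y x = sumℚ (λ i → f i ℚ.* y i) ℚ.+ sumℚ (λ i → sumℚ (λ j → c i j ℚ.* x i j))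

  value : (Fin F → ℚ) → (Fin F → Fin C → ℚ) → (Fin F → Bool) → (Fin C → Fin F) → ℚ
  value f c O A = sumℚ (λ i → f i ℚ.* bitℚ (O i)) ℚ.+ sumℚ (λ j → c (A j) j)

  dot-assignment : ∀ f c O A →
    dot f c (λ i → bitℚ (O i)) (λ i j → bitℚ (does (A j ≟ i))) ≡ value f c O A
  dot-assignment f c O A = cong (sumℚ (λ i → f i ℚ.* bitℚ (O i)) ℚ.+_)
    (trans (Σℚ.∑-comm (λ i j → c i j ℚ.* bitℚ (does (A j ≟ i))))
      (Σℚ.sum-cong-≗ (λ j → sumℚ-indicator (λ i → c i j) (A j))))

  dot-average : ∀ {M N} q f c (y : Fin M → Fin N → Fin F → ℚ) (x : Fin M → Fin N → Fin F → Fin C → ℚ) →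
    dot f c (λ i → average q (λ τ ρ → y τ ρ i)) (λ i j → average q (λ τ ρ → x τ ρ i j)) ≡
    average q (λ τ ρ → dot f c (y τ ρ) (x τ ρ))
  dot-average q f c y x = trans (cong₂ ℚ._+_
    (trans (Σℚ.sum-cong-≗ (λ i → average-* q (f i) (λ τ ρ → y τ ρ i)))
      (average-sum q (λ i τ ρ → f i ℚ.* y τ ρ i)))
    (trans (Σℚ.sum-cong-≗ (λ i → trans
        (Σℚ.sum-cong-≗ (λ j → average-* q (c i j) (λ τ ρ → x τ ρ i j)))
        (average-sum q (λ j τ ρ → c i j ℚ.* x τ ρ i j))))
      (average-sum q (λ i τ ρ → sumℚ (λ j → c i j ℚ.* x τ ρ i j)))))
    (sym (average-+ q (λ τ ρ → sumℚ (λ i → f i ℚ.* y τ ρ i))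
      (λ τ ρ → sumℚ (λ i → sumℚ (λ j → c i j ℚ.* x τ ρ i j)))))

module _ {a n : ℕ} where

  facAt : Vec a n → ℕ → Facility n → ℚ
  facAt v t i = seq (fac v i) t

  pairAt : Vec a n → ℕ → Facility n → Client a n → ℚ
  pairAt v t i j = seq (pair v i j) t

  -- Sums and products of reals are formed term by term, so linear algebra can be done over the
  -- rationals, one index `t` at a time.
  seq-∙ : (u v : Vec a n) → ∀ t → seq (u ∙ v) t ≡ dot (facAt u t) (pairAt u t) (facAt v t) (pairAt v t)
  seq-∙ u v t = cong₂ ℚ._+_ (seq-∑ (λ i → fac u i *ᵣ fac v i) t)
    (trans (seq-∑ (λ i → ∑ (λ j → pair u i j *ᵣ pair v i j)) t)
      (Σℚ.sum-cong-≗ (λ i → seq-∑ (λ j → pair u i j *ᵣ pair v i j) t)))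

  _≼_ : Vec a n → Vec a n → Set
  u ≼ v = (∀ i → fac u i ≤ᵣ fac v i) × (∀ i j → pair u i j ≤ᵣ pair v i j)

  rational : (Facility n → ℚ) → (Facility n → Client a n → ℚ) → Vec a n
  rational f c = (λ i → fromℚ (f i)) ,, (λ i j → fromℚ (c i j))

  ∙-monoʳ : ∀ f c (u v : Vec a n) → (∀ i → 0ℚ ℚ.≤ f i) → (∀ i j → 0ℚ ℚ.≤ c i j) →
    u ≼ v → rational f c ∙ u ≤ᵣ rational f c ∙ v
  ∙-monoʳ f c u v 0≤f 0≤c (u≤v , u≤v′) = +ᵣ-mono
    (∑ (λ i → fromℚ (f i) *ᵣ fac u i)) (∑ (λ i → fromℚ (f i) *ᵣ fac v i))
    (∑ (λ i → ∑ (λ j → fromℚ (c i j) *ᵣ pair u i j))) (∑ (λ i → ∑ (λ j → fromℚ (c i j) *ᵣ pair v i j)))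
    (∑-mono (λ i → fromℚ (f i) *ᵣ fac u i) (λ i → fromℚ (f i) *ᵣ fac v i)
      (λ i → fromℚ-*-mono (f i) (fac u i) (fac v i) (0≤f i) (u≤v i)))
    (∑-mono (λ i → ∑ (λ j → fromℚ (c i j) *ᵣ pair u i j)) (λ i → ∑ (λ j → fromℚ (c i j) *ᵣ pair v i j))
      (λ i → ∑-mono (λ j → fromℚ (c i j) *ᵣ pair u i j) (λ j → fromℚ (c i j) *ᵣ pair v i j)
        (λ j → fromℚ-*-mono (c i j) (pair u i j) (pair v i j) (0≤c i j) (u≤v′ i j))))

  ∙-combination : ∀ {s} (w : Vec a n) (t : Fin s → ℝ) (p : Fin s → Vec a n) →
    ∑ (λ e → t e *ᵣ (w ∙ p e)) ≤ᵣ w ∙ combination t p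
  ∙-combination w t p = pointwise-≡ (∑ (λ e → t e *ᵣ (w ∙ p e))) (w ∙ combination t p) λ T → let
      f = facAt w T
      c = pairAt w T
      q : _ → ℚ
      q e = seq (t e) T
    in begin
    seq (∑ (λ e → t e *ᵣ (w ∙ p e))) T
      ≡⟨ seq-∑ (λ e → t e *ᵣ (w ∙ p e)) T ⟩
    sumℚ (λ e → q e ℚ.* seq (w ∙ p e) T)
      ≡⟨ Σℚ.sum-cong-≗ (λ e → cong (q e ℚ.*_) (seq-∙ w (p e) T)) ⟩
    sumℚ (λ e → q e ℚ.* dot f c (facAt (p e) T) (pairAt (p e) T))
      ≡⟨ linear f c q (λ e → facAt (p e) T) (λ e → pairAt (p e) T) ⟩
    dot f c (λ i → sumℚ (λ e → q e ℚ.* facAt (p e) T i)) (λ i j → sumℚ (λ e → q e ℚ.* pairAt (p e) T i j))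
      ≡⟨ cong₂ ℚ._+_
           (Σℚ.sum-cong-≗ (λ i → cong (f i ℚ.*_) (seq-∑ (λ e → t e *ᵣ fac (p e) i) T)))
           (Σℚ.sum-cong-≗ (λ i → Σℚ.sum-cong-≗ (λ j →
             cong (c i j ℚ.*_) (seq-∑ (λ e → t e *ᵣ pair (p e) i j) T)))) ⟨
    dot f c (facAt (combination t p) T) (pairAt (combination t p) T)
      ≡⟨ seq-∙ w (combination t p) T ⟨
    seq (w ∙ combination t p) T ∎
    where
    open ≡-Reasoning
    move : ∀ {s N} (q : Fin s → ℚ) (f : Fin N → ℚ) (y : Fin s → Fin N → ℚ) →
      sumℚ (λ e → q e ℚ.* sumℚ (λ i → f i ℚ.* y e i)) ≡ sumℚ (λ i → f i ℚ.* sumℚ (λ e → q e ℚ.* y e i))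
    move q f y = begin
      sumℚ (λ e → q e ℚ.* sumℚ (λ i → f i ℚ.* y e i))
        ≡⟨ Σℚ.sum-cong-≗ (λ e → Σℚ.*-distribˡ-sum (q e) (λ i → f i ℚ.* y e i)) ⟩
      sumℚ (λ e → sumℚ (λ i → q e ℚ.* (f i ℚ.* y e i)))
        ≡⟨ Σℚ.∑-comm (λ e i → q e ℚ.* (f i ℚ.* y e i)) ⟩
      sumℚ (λ i → sumℚ (λ e → q e ℚ.* (f i ℚ.* y e i)))
        ≡⟨ Σℚ.sum-cong-≗ (λ i → trans
             (Σℚ.sum-cong-≗ (λ e → solve 3 (λ q f y → q :* (f :* y) := f :* (q :* y)) refl (q e) (f i) (y e i)))
             (sym (Σℚ.*-distribˡ-sum (f i) (λ e → q e ℚ.* y e i)))) ⟩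
      sumℚ (λ i → f i ℚ.* sumℚ (λ e → q e ℚ.* y e i)) ∎
      where open +-*-Solver
    linear : ∀ {s} f c (q : Fin s → ℚ) (y : Fin s → Facility n → ℚ) (x : Fin s → Facility n → Client a n → ℚ) →
      sumℚ (λ e → q e ℚ.* dot f c (y e) (x e)) ≡
      dot f c (λ i → sumℚ (λ e → q e ℚ.* y e i)) (λ i j → sumℚ (λ e → q e ℚ.* x e i j))
    linear f c q y x = begin
      sumℚ (λ e → q e ℚ.* dot f c (y e) (x e))
        ≡⟨ Σℚ.sum-cong-≗ (λ e → ℚP.*-distribˡ-+ (q e) (sumℚ (λ i → f i ℚ.* y e i)) _) ⟩
      sumℚ (λ e → q e ℚ.* sumℚ (λ i → f i ℚ.* y e i) ℚ.+ q e ℚ.* sumℚ (λ i → inner e i))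
        ≡⟨ Σℚ.∑-distrib-+ (λ e → q e ℚ.* sumℚ (λ i → f i ℚ.* y e i)) (λ e → q e ℚ.* sumℚ (inner e)) ⟩
      sumℚ (λ e → q e ℚ.* sumℚ (λ i → f i ℚ.* y e i)) ℚ.+ sumℚ (λ e → q e ℚ.* sumℚ (inner e))
        ≡⟨ cong₂ ℚ._+_ (move q f y) (begin
             sumℚ (λ e → q e ℚ.* sumℚ (inner e))
               ≡⟨ Σℚ.sum-cong-≗ (λ e → Σℚ.*-distribˡ-sum (q e) (inner e)) ⟩
             sumℚ (λ e → sumℚ (λ i → q e ℚ.* inner e i))
               ≡⟨ Σℚ.∑-comm (λ e i → q e ℚ.* inner e i) ⟩
             sumℚ (λ i → sumℚ (λ e → q e ℚ.* inner e i))
               ≡⟨ Σℚ.sum-cong-≗ (λ i → move q (c i) (λ e → x e i)) ⟩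
             sumℚ (λ i → sumℚ (λ j → c i j ℚ.* sumℚ (λ e → q e ℚ.* x e i j))) ∎) ⟩
      _ ∎
      where
      inner : _ → Facility n → ℚ
      inner e i = sumℚ (λ j → c i j ℚ.* x e i j)

  -- A non-negative weight does not shrink when multiplied by a cost of at least 1, hence 1 ≤ ∑ t ≤
  -- ∑ t (w ∙ p) ≤ w ∙ z.
  conv-lower-bound : ∀ f c (S : Vec a n → Set) → (∀ i → 0ℚ ℚ.≤ f i) → (∀ i j → 0ℚ ℚ.≤ c i j) →
    (∀ p → S p → 1ᵣ ≤ᵣ rational f c ∙ p) → ∀ z → conv S z → 1ᵣ ≤ᵣ rational f c ∙ z
  conv-lower-bound f c S 0≤f 0≤c bound z (s , t , p , 0≤t , (_ , 1≤∑t) , Sp , (_≈_ , _≈′_)) =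
    ≤ᵣ-trans 1ᵣ (∑ t) (w ∙ z) 1≤∑t
    (≤ᵣ-trans (∑ t) (∑ λ e → t e *ᵣ (w ∙ p e)) (w ∙ z)
      (∑-mono t (λ e → t e *ᵣ (w ∙ p e)) (λ e → t≤t*x (t e) (w ∙ p e) (0≤t e) (bound (p e) (Sp e))))
    (≤ᵣ-trans (∑ λ e → t e *ᵣ (w ∙ p e)) (w ∙ combination t p) (w ∙ z) (∙-combination w t p)
      (∙-monoʳ f c (combination t p) z 0≤f 0≤c
        ((λ i → proj₂ (_≈_ i)) , (λ i j → proj₂ (_≈′_ i j))))))
    where
    w = rational f c

  ≋-refl : (z : Vec a n) → z ≋ z
  ≋-refl z = (λ i → refl≤ (fac z i) , refl≤ (fac z i)) , (λ i j → refl≤ (pair z i j) , refl≤ (pair z i j))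
    where
    refl≤ : ∀ x → x ≤ᵣ x
    refl≤ x = pointwise-≡ x x (λ _ → refl)

  solution∈P : (s : Solution a n) → P (toVec s)
  solution∈P s = 1 , (λ _ → 1ᵣ) , (λ _ → toVec s)
    , (λ _ → pointwise-≤ 0ᵣ 1ᵣ (λ _ → ℚP.<⇒≤ 0<1))
    , (pointwise-≡ (∑ {1} λ _ → 1ᵣ) 1ᵣ (λ _ → refl) , pointwise-≡ 1ᵣ (∑ {1} λ _ → 1ᵣ) (λ _ → refl))
    , (λ _ → s , ≋-refl (toVec s))
    , (λ i → once (fac (toVec s) i)) , (λ i j → once (pair (toVec s) i j))
    where
    once : ∀ x → x ≈ᵣ 1ᵣ *ᵣ x +ᵣ 0ᵣ
    once x = pointwise-≡ x (1ᵣ *ᵣ x +ᵣ 0ᵣ) (λ t → sym (unit (seq x t)))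
           , pointwise-≡ (1ᵣ *ᵣ x +ᵣ 0ᵣ) x (λ t → unit (seq x t))
      where
      unit : ∀ q → 1ℚ ℚ.* q ℚ.+ 0ℚ ≡ q
      unit q = trans (ℚP.+-identityʳ (1ℚ ℚ.* q)) (ℚP.*-identityˡ q)

  negate : Vec a n → Vec a n
  negate v = (λ i → fromℚ (ℚ.- 1ℚ) *ᵣ fac v i) ,, (λ i j → fromℚ (ℚ.- 1ℚ) *ᵣ pair v i j)

  seq-negate : ∀ u z t → seq (negate u ∙ z) t ≡ ℚ.- seq (u ∙ z) t
  seq-negate u z t = begin
    seq (negate u ∙ z) t
      ≡⟨ seq-∙ (negate u) z t ⟩
    dot (λ i → (ℚ.- 1ℚ) ℚ.* facAt u t i) (λ i j → (ℚ.- 1ℚ) ℚ.* pairAt u t i j) (facAt z t) (pairAt z t)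
      ≡⟨ cong₂ ℚ._+_ (pull (facAt u t) (facAt z t))
           (trans (Σℚ.sum-cong-≗ (λ i → pull (pairAt u t i) (pairAt z t i)))
             (sym (Σℚ.*-distribˡ-sum (ℚ.- 1ℚ) (λ i → sumℚ (λ j → pairAt u t i j ℚ.* pairAt z t i j))))) ⟩
    (ℚ.- 1ℚ) ℚ.* X ℚ.+ (ℚ.- 1ℚ) ℚ.* Y
      ≡⟨ ℚP.*-distribˡ-+ (ℚ.- 1ℚ) X Y ⟨
    (ℚ.- 1ℚ) ℚ.* (X ℚ.+ Y)
      ≡⟨ trans (sym (ℚP.neg-distribˡ-* 1ℚ (X ℚ.+ Y))) (cong ℚ.-_ (ℚP.*-identityˡ (X ℚ.+ Y))) ⟩
    ℚ.- (X ℚ.+ Y)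
      ≡⟨ cong ℚ.-_ (seq-∙ u z t) ⟨
    ℚ.- seq (u ∙ z) t ∎
    where
    open ≡-Reasoning
    X Y : ℚ
    X = sumℚ (λ i → facAt u t i ℚ.* facAt z t i)
    Y = sumℚ (λ i → sumℚ (λ j → pairAt u t i j ℚ.* pairAt z t i j))
    pull : ∀ {N} (f y : Fin N → ℚ) →
      sumℚ (λ i → (ℚ.- 1ℚ) ℚ.* f i ℚ.* y i) ≡ (ℚ.- 1ℚ) ℚ.* sumℚ (λ i → f i ℚ.* y i)
    pull f y = trans (Σℚ.sum-cong-≗ (λ i → ℚP.*-assoc (ℚ.- 1ℚ) (f i) (y i)))
      (sym (Σℚ.*-distribˡ-sum (ℚ.- 1ℚ) (λ i → f i ℚ.* y i)))

  -- The row is turned into the objective `negate (A e)`. On the polyhedron its value is at least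
  -- minus `b e`, and `relaxation` carries this lower bound over to `P`, hence to the solution.
  valid : ∀ {g m} {A : Fin m → Vec a n} {b : Fin m → ℝ} → ApproximateFormulation g A b →
    ∀ s e → A e ∙ toVec s ≤ᵣ b e
  valid {A = A} {b} formulation s e ε 0<ε =
    let N , p = ApproximateFormulation.relaxation formulation (negate (A e)) (fromℚ (ℚ.- 1ℚ) *ᵣ b e)
                  below (toVec s) (solution∈P s) ε 0<ε
    in N , λ t ht → swap (seq (A e ∙ toVec s) t) (seq (b e) t) ε
         (subst₂ (λ x y → x ℚ.≤ y ℚ.+ ε) (minus (seq (b e) t)) (seq-negate (A e) (toVec s) t) (p t ht))
    where
    minus : ∀ x → (ℚ.- 1ℚ) ℚ.* x ≡ ℚ.- x
    minus x = trans (sym (ℚP.neg-distribˡ-* 1ℚ x)) (cong ℚ.-_ (ℚP.*-identityˡ x))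
    swap : ∀ x y ε → ℚ.- y ℚ.≤ ℚ.- x ℚ.+ ε → x ℚ.≤ y ℚ.+ ε
    swap x y ε h = begin
      x                             ≡⟨ solve 2 (λ x y → x := (:- y) :+ (x :+ y)) refl x y ⟩
      ℚ.- y ℚ.+ (x ℚ.+ y)           ≤⟨ ℚP.+-monoˡ-≤ (x ℚ.+ y) h ⟩
      ℚ.- x ℚ.+ ε ℚ.+ (x ℚ.+ y)     ≡⟨ solve 3 (λ x y ε → (:- x) :+ ε :+ (x :+ y) := y :+ ε) refl x y ε ⟩
      y ℚ.+ ε                       ∎
      where
      open ℚP.≤-Reasoning
      open +-*-Solver
    swap′ : ∀ x y ε → x ℚ.≤ y ℚ.+ ε → ℚ.- y ℚ.≤ ℚ.- x ℚ.+ ε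
    swap′ x y ε h = begin
      ℚ.- y                         ≡⟨ solve 2 (λ x y → :- y := x :+ (:- x :- y)) refl x y ⟩
      x ℚ.+ (ℚ.- x ℚ.- y)           ≤⟨ ℚP.+-monoˡ-≤ (ℚ.- x ℚ.- y) h ⟩
      y ℚ.+ ε ℚ.+ (ℚ.- x ℚ.- y)     ≡⟨ solve 3 (λ x y ε → y :+ ε :+ (:- x :- y) := :- x :+ ε) refl x y ε ⟩
      ℚ.- x ℚ.+ ε                   ∎
      where
      open ℚP.≤-Reasoning
      open +-*-Solver
    below : ∀ z → Polyhedron A b z → fromℚ (ℚ.- 1ℚ) *ᵣ b e ≤ᵣ negate (A e) ∙ z
    below z z∈ ε 0<ε = let N , p = z∈ e ε 0<ε in N , λ t ht →
      subst₂ (λ x y → x ℚ.≤ y ℚ.+ ε) (sym (minus (seq (b e) t))) (sym (seq-negate (A e) z t))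
        (swap′ (seq (A e ∙ z) t) (seq (b e) t) ε (p t ht))

-- The points cut off by a formulation

bitℚ≥0 : ∀ b → 0ℚ ℚ.≤ bitℚ b
bitℚ≥0 b = 0≤natℚ (bitℕ b)

-- If `p` and `q` are on different sides, the detour over `q′` and `p′` has to cross the cut
-- somewhere.
xor-metric : ∀ p p′ q q′ →
  bitℕ (p xor q) ≤ bitℕ (p′ xor q) ℕ.+ bitℕ (p′ xor q′) ℕ.+ bitℕ (p xor q′)
xor-metric false p′    false q′    = z≤n
xor-metric true  p′    true  q′    = z≤n
xor-metric false false true  q′    = s≤s z≤n
xor-metric false true  true  false = s≤s z≤n
xor-metric false true  true  true  = s≤s z≤n
xor-metric true  true  false q′    = s≤s z≤n
xor-metric true  false false false = s≤s z≤n
xor-metric true  false false true  = s≤s z≤n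

module Cuts (a n K₀ B₀ L : ℕ)
  (capacity-eq : suc B₀ ℕ.+ suc K₀ ≡ n ^ 3)
  (facility-eq : suc (L ℕ.+ suc (suc K₀) ℕ.* n) ≡ n ^ 2)
  (remote-eq : suc L ℕ.* n ^ 3 ≡ a ℕ.* n ^ 4)
  (home-fits : suc (suc (suc K₀) ℕ.* n ^ 3) ≤ a ℕ.* n ^ 4)
  where

  open Layout a n K₀ B₀ L capacity-eq facility-eq remote-eq home-fits public

  kK>0 : 0ℚ ℚ.< natℚ k ℚ.* natℚ K
  kK>0 = subst (0ℚ ℚ.<_) (natℚ-* k K)
    (ℚP.<-≤-trans 0<1 (natℚ-mono {1} {k ℕ.* K} (s≤s z≤n)))

  -- The weight 1 / (k K) of a scenario.
  share : ℚ
  share = proj₁ (divide 1ℚ (natℚ k ℚ.* natℚ K) 0<1 kK>0)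

  share>0 : 0ℚ ℚ.< share
  share>0 = proj₁ (proj₂ (divide 1ℚ (natℚ k ℚ.* natℚ K) 0<1 kK>0))

  share-unit : share ℚ.* (natℚ k ℚ.* natℚ K) ≡ 1ℚ
  share-unit = trans (ℚP.*-comm share _) (proj₂ (proj₂ (divide 1ℚ (natℚ k ℚ.* natℚ K) 0<1 kK>0)))

  routed : Fin k → Choice → Fin k → Fin K → Client a n → Facility n
  routed r φ τ ρ j = facility (target r (kind j) τ ρ φ)

  mixedRoute : Fin k → Choice → Choice → Fin k → Fin K → Client a n → Facility n
  mixedRoute r φ ψ τ ρ j = facility (mixed r (kind j) τ ρ φ ψ)

  -- An arbitrary overloaded group; `average-independent` later exchanges it for one where two
  -- choices differ.
  start : Fin k
  start = zero

  point : Choice → Vec a n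
  point φ = rational
    (λ i → average {k} {K} share (λ τ ρ → bitℚ (isOpen τ i)))
    (λ i j → average {k} {K} share (λ τ ρ → bitℚ (does (routed start φ τ ρ j ≟ i))))

  weights : Choice → Vec a n
  weights φ = rational (λ i → bitℚ (isHub i)) (λ i j → bitℚ (apart φ i j))

  module _ (f : Facility n → ℚ) (c : Facility n → Client a n → ℚ) where

    val : (Fin k → Fin K → Client a n → Facility n) → Fin k → Fin K → ℚ
    val A τ ρ = value f c (isOpen τ) (A τ ρ)

    openings : Fin k → ℚ
    openings τ = sumℚ (λ i → f i ℚ.* bitℚ (isOpen τ i))

    dot-point : ∀ φ t →
      dot f c (facAt (point φ) t) (pairAt (point φ) t) ≡ average {k} {K} share (val (routed start φ))
    dot-point φ t = trans
      (dot-average {M = k} {N = K} share f c (λ τ ρ i → bitℚ (isOpen τ i))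
        (λ τ ρ i j → bitℚ (does (routed start φ τ ρ j ≟ i))))
      (average-cong {k} {K} share (λ τ ρ → dot-assignment f c (isOpen τ) (routed start φ τ ρ)))

    average-split : (A : Fin k → Fin K → Client a n → Facility n) →
      average {k} {K} share (val A) ≡
      average {k} {K} share (λ τ ρ → openings τ) ℚ.+ sumℚ (λ j → average {k} {K} share (λ τ ρ → c (A τ ρ j) j))
    average-split A = trans
      (average-+ {k} {K} share (λ τ ρ → openings τ) (λ τ ρ → sumℚ (λ j → c (A τ ρ j) j)))
      (cong (average {k} {K} share (λ τ ρ → openings τ) ℚ.+_)
        (sym (average-sum {k} {K} share (λ j τ ρ → c (A τ ρ j) j))))

    average-independent : ∀ φ r → average {k} {K} share (val (routed start φ)) ≡ average {k} {K} share (val (routed r φ))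
    average-independent φ r = trans (average-split (routed start φ)) (trans
      (cong (average {k} {K} share (λ τ ρ → openings τ) ℚ.+_) (Σℚ.sum-cong-≗ (λ j →
        cong (share ℚ.*_) (target-sum-independent (λ x → c (facility x) j) φ start r (kind j)))))
      (sym (average-split (routed r φ))))

    val-swap : ∀ φ ψ r τ ρ →
      val (mixedRoute r φ ψ) τ ρ ℚ.+ val (mixedRoute r ψ φ) τ ρ ≡
      val (routed r φ) τ ρ ℚ.+ val (routed r ψ) τ ρ
    val-swap φ ψ r τ ρ = trans (regroup O V V′) (trans
      (cong (O ℚ.+ O ℚ.+_) (trans (sym (Σℚ.∑-distrib-+ (λ j → c (mixedRoute r φ ψ τ ρ j) j) _)) (trans
        (Σℚ.sum-cong-≗ (λ j → mixed-swap (λ x → c (facility x) j) φ ψ r τ ρ (kind j)))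
        (Σℚ.∑-distrib-+ (λ j → c (routed r φ τ ρ j) j) _))))
      (sym (regroup O W W′)))
      where
      O V V′ W W′ : ℚ
      O = openings τ
      V = sumℚ (λ j → c (mixedRoute r φ ψ τ ρ j) j)
      V′ = sumℚ (λ j → c (mixedRoute r ψ φ τ ρ j) j)
      W = sumℚ (λ j → c (routed r φ τ ρ j) j)
      W′ = sumℚ (λ j → c (routed r ψ τ ρ j) j)
      regroup : ∀ o x y → (o ℚ.+ x) ℚ.+ (o ℚ.+ y) ≡ o ℚ.+ o ℚ.+ (x ℚ.+ y)
      regroup = solve 3 (λ o x y → (o :+ x) :+ (o :+ y) := o :+ o :+ (x :+ y)) refl
        where open +-*-Solver

    -- Both points are first rewritten with group `r` overloaded, then their scenarios are blended
    -- in pairs. If `φ r ≢ ψ r`, every term on the right is a sum of two values at integer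
    -- solutions.
    dot-two-points : ∀ φ ψ r t →
      dot f c (facAt (point φ) t) (pairAt (point φ) t) ℚ.+ dot f c (facAt (point ψ) t) (pairAt (point ψ) t) ≡
      average {k} {K} share (λ τ ρ → val (mixedRoute r φ ψ) τ ρ ℚ.+ val (mixedRoute r ψ φ) τ ρ)
    dot-two-points φ ψ r t = begin
      _ ≡⟨ cong₂ ℚ._+_ (trans (dot-point φ t) (average-independent φ r))
             (trans (dot-point ψ t) (average-independent ψ r)) ⟩
      average {k} {K} share (val (routed r φ)) ℚ.+ average {k} {K} share (val (routed r ψ))
        ≡⟨ average-+ {k} {K} share (val (routed r φ)) (val (routed r ψ)) ⟨
      average {k} {K} share (λ τ ρ → val (routed r φ) τ ρ ℚ.+ val (routed r ψ) τ ρ)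
        ≡⟨ average-cong {k} {K} share (val-swap φ ψ r) ⟨
      _ ∎
      where open ≡-Reasoning

  admissible : ∀ φ → Admissible (weights φ)
  admissible φ = record
    { opening≥0    = λ i → pointwise-≤ 0ᵣ (fac (weights φ) i) (λ _ → bitℚ≥0 (isHub i))
    ; connection≥0 = λ i j → pointwise-≤ 0ᵣ (pair (weights φ) i j) (λ _ → bitℚ≥0 (apart φ i j))
    ; metric       = λ i i′ j j′ → pointwise-≤ (pair (weights φ) i j)
        (pair (weights φ) i′ j +ᵣ pair (weights φ) i′ j′ +ᵣ pair (weights φ) i j′)
        (λ _ → triangle (near φ i) (near φ i′) (home (kind j)) (home (kind j′)))
    }
    where
    triangle : ∀ p p′ q q′ →
      bitℚ (p xor q) ℚ.≤ bitℚ (p′ xor q) ℚ.+ bitℚ (p′ xor q′) ℚ.+ bitℚ (p xor q′)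
    triangle p p′ q q′ = ℚP.≤-trans (natℚ-mono (xor-metric p p′ q q′)) (ℚP.≤-reflexive
      (trans (natℚ-+ (bitℕ (p′ xor q) ℕ.+ bitℕ (p′ xor q′)) (bitℕ (p xor q′)))
        (cong (ℚ._+ bitℚ (p xor q′)) (natℚ-+ (bitℕ (p′ xor q)) (bitℕ (p′ xor q′))))))

  solution-cost : ∀ φ s → 1ᵣ ≤ᵣ weights φ ∙ toVec s
  solution-cost φ s = pointwise-≤ 1ᵣ (weights φ ∙ toVec s) λ t → ℚP.≤-trans
    (natℚ-mono (cost≥1 φ s)) (ℚP.≤-reflexive (trans (natural φ s) (sym (seq-∙ (weights φ) (toVec s) t))))
    where
    natural-sum : ∀ {N} (f g : Fin N → ℕ) →
      natℚ (sum (λ i → f i ℕ.* g i)) ≡ sumℚ (λ i → natℚ (f i) ℚ.* natℚ (g i))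
    natural-sum f g = trans (natℚ-sum (λ i → f i ℕ.* g i)) (Σℚ.sum-cong-≗ (λ i → natℚ-* (f i) (g i)))
    natural : ∀ φ s → natℚ (hubCost φ s ℕ.+ sum (travel φ s)) ≡
      dot (λ i → bitℚ (isHub i)) (λ i j → bitℚ (apart φ i j)) (λ i → natℚ (yℕ φ s i)) (λ i j → natℚ (xℕ φ s i j))
    natural φ s = trans (natℚ-+ (hubCost φ s) (sum (travel φ s))) (cong₂ ℚ._+_
      (natural-sum (λ i → bitℕ (isHub i)) (yℕ φ s))
      (trans (natℚ-sum (travel φ s)) (Σℚ.sum-cong-≗ (λ i → natural-sum (λ j → bitℕ (apart φ i j)) (xℕ φ s i)))))

  P-cost : ∀ φ z → P z → 1ᵣ ≤ᵣ weights φ ∙ z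
  P-cost φ = conv-lower-bound f c P₀ 0≤f 0≤c
    λ p (s , (e , e′)) → ≤ᵣ-trans 1ᵣ (weights φ ∙ toVec s) (weights φ ∙ p) (solution-cost φ s)
      (∙-monoʳ f c (toVec s) p 0≤f 0≤c ((λ i → proj₂ (e i)) , (λ i j → proj₂ (e′ i j))))
    where
    f : Facility n → ℚ
    f i = bitℚ (isHub i)
    c : Facility n → Client a n → ℚ
    c i j = bitℚ (apart φ i j)
    0≤f : ∀ i → 0ℚ ℚ.≤ f i
    0≤f i = bitℚ≥0 (isHub i)
    0≤c : ∀ i j → 0ℚ ℚ.≤ c i j
    0≤c i j = bitℚ≥0 (apart φ i j)

  -- Connections are free by `target-near`, and the hub is open in `K` of the `k * K` scenarios,
  -- those with `τ = zero`. The value is 1 / k.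
  point-cost : ∀ φ t → seq (weights φ ∙ point φ) t ≡ share ℚ.* natℚ K
  point-cost φ t = begin
    seq (weights φ ∙ point φ) t
      ≡⟨ trans (seq-∙ (weights φ) (point φ) t) (dot-point f c φ t) ⟩
    average {k} {K} share (val f c (routed start φ))
      ≡⟨ average-cong {k} {K} share (λ τ ρ → cong₂ ℚ._+_ (opening τ)
           (sumℚ-zero _ (λ j → cong bitℚ (target-near φ start τ ρ j)))) ⟩
    average {k} {K} share (λ τ ρ → first τ ℚ.+ 0ℚ)
      ≡⟨ cong (share ℚ.*_) (cong₂ ℚ._+_
           (trans (sumℚ-const K 1ℚ) (ℚP.*-identityʳ (natℚ K)))
           (sumℚ-zero {K} _ (λ τ → sumℚ-zero {K} _ (λ ρ → refl)))) ⟩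
    share ℚ.* (natℚ K ℚ.+ 0ℚ)
      ≡⟨ cong (share ℚ.*_) (ℚP.+-identityʳ (natℚ K)) ⟩
    share ℚ.* natℚ K ∎
    where
    open ≡-Reasoning
    f : Facility n → ℚ
    f i = bitℚ (isHub i)
    c : Facility n → Client a n → ℚ
    c i j = bitℚ (apart φ i j)
    first : Fin k → ℚ
    first zero    = 1ℚ
    first (suc τ) = 0ℚ
    closed : ∀ b → bitℚ b ℚ.* bitℚ (not b) ≡ 0ℚ
    closed true  = refl
    closed false = refl
    opening : ∀ τ → openings f c τ ≡ first τ
    opening zero    = trans (Σℚ.sum-cong-≗ (λ i → ℚP.*-comm (f i) 1ℚ)) (sumℚ-indicator (λ _ → 1ℚ) (facility hub))
    opening (suc τ) = sumℚ-zero _ (λ i → closed (isHub i))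

  module _ {g : ℝ} (g≤K : g ≤ᵣ fromℕ K) {m : ℕ} {A : Fin m → Vec a n} {b : Fin m → ℝ}
    (formulation : ApproximateFormulation g A b) where

    -- This is 1 / K, against the cost 1 / k of the points.
    bound : ℚ
    bound = share ℚ.* natℚ k

    g*bound≤1 : g *ᵣ fromℚ bound ≤ᵣ 1ᵣ
    g*bound≤1 = ≤ᵣ-trans (g *ᵣ fromℚ bound) (fromℚ bound *ᵣ g) 1ᵣ
      (pointwise-≡ (g *ᵣ fromℚ bound) (fromℚ bound *ᵣ g) (λ t → ℚP.*-comm (seq g t) bound))
      (≤ᵣ-trans (fromℚ bound *ᵣ g) (fromℚ bound *ᵣ fromℕ K) 1ᵣ
        (fromℚ-*-mono bound g (fromℕ K) 0≤bound g≤K)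
        (pointwise-≡ (fromℚ bound *ᵣ fromℕ K) 1ᵣ
          (λ t → trans (ℚP.*-assoc share (natℚ k) (natℚ K)) share-unit)))
      where
      0≤bound : 0ℚ ℚ.≤ bound
      0≤bound = ℚP.≤-trans (ℚP.≤-reflexive (sym (ℚP.*-zeroʳ share)))
        (ℚP.*-monoˡ-≤-nonNeg share {{ℚ.nonNegative (ℚP.<⇒≤ share>0)}} (0≤natℚ k))

    -- All of `P` costs at least 1, and `g` times `bound` is at most 1, so by `gap` every point of
    -- the polyhedron costs at least 1 / K. This point costs only 1 / k.
    point∉polyhedron : ∀ φ → ¬ Polyhedron A b (point φ)
    point∉polyhedron φ point∈ = ℚP.<-irrefl refl (ℚP.<-≤-trans smaller (fromℚ-cancel-≤ bound (share ℚ.* natℚ K)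
      (≤ᵣ-trans (fromℚ bound) (weights φ ∙ point φ) (fromℚ (share ℚ.* natℚ K))
        (ApproximateFormulation.gap formulation (weights φ) (admissible φ) (fromℚ bound)
          (λ z z∈P → ≤ᵣ-trans (g *ᵣ fromℚ bound) 1ᵣ (weights φ ∙ z) g*bound≤1 (P-cost φ z z∈P))
          (point φ) point∈)
        (pointwise-≡ (weights φ ∙ point φ) (fromℚ (share ℚ.* natℚ K)) (point-cost φ)))))
      where
      smaller : share ℚ.* natℚ K ℚ.< bound
      smaller = ℚP.*-monoʳ-<-pos share {{ℚ.positive share>0}} (subst (natℚ K ℚ.<_) (sym (natℚ-+ 1 K))
        (ℚP.≤-<-trans (ℚP.≤-reflexive (sym (ℚP.+-identityˡ (natℚ K)))) (ℚP.+-monoˡ-< (natℚ K) 0<1)))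

    -- By `valid` each mixed solution satisfies row `e` up to `δ` from some index on. There are
    -- finitely many of them, so one index serves all, and from there on averaging bounds the sum of
    -- the two points.
    two-points : ∀ φ ψ r → φ r ≢ ψ r → ∀ e → A e ∙ point φ +ᵣ A e ∙ point ψ ≤ᵣ b e +ᵣ b e
    two-points φ ψ r φ≢ψ e ε 0<ε =
      let δ , 0<δ , δ+δ = half ε 0<ε
          M , p = holds φ ψ φ≢ψ δ 0<δ
          N , q = holds ψ φ (φ≢ψ ∘ sym) δ 0<δ
      in M ℕ.⊔ N , λ t ht → ℚP.≤-trans
        (averaged δ t (p t (ℕP.m⊔n≤o⇒m≤o M N ht)) (q t (ℕP.m⊔n≤o⇒n≤o M N ht)))
        (ℚP.≤-reflexive (trans (regroup (seq (b e) t) δ) (cong (seq (b e) t ℚ.+ seq (b e) t ℚ.+_) δ+δ)))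
      where
      v : (Fin k → Fin K → Client a n → Facility n) → ℕ → Fin k → Fin K → ℚ
      v R t = val (facAt (A e) t) (pairAt (A e) t) R
      holds : ∀ φ ψ → φ r ≢ ψ r → ∀ δ → 0ℚ ℚ.< δ → Σ[ N ∈ ℕ ] (∀ t → N ≤ t → ∀ τ ρ →
        v (mixedRoute r φ ψ) t τ ρ ℚ.≤ seq (b e) t ℚ.+ δ)
      holds φ ψ φ≢ψ δ 0<δ = eventually-all
        (λ τ t → ∀ ρ → v (mixedRoute r φ ψ) t τ ρ ℚ.≤ seq (b e) t ℚ.+ δ)
        (λ τ → eventually-all (λ ρ t → v (mixedRoute r φ ψ) t τ ρ ℚ.≤ seq (b e) t ℚ.+ δ)
          (λ ρ → let s = mixedSolution r φ ψ φ≢ψ τ ρ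
                     N , p = valid formulation s e δ 0<δ
                 in N , λ t ht → ℚP.≤-trans (ℚP.≤-reflexive (sym (trans (seq-∙ (A e) (toVec s) t)
                      (dot-assignment (facAt (A e) t) (pairAt (A e) t) (isOpen τ) (mixedRoute r φ ψ τ ρ)))))
                      (p t ht)))
      regroup : ∀ x δ → (x ℚ.+ δ) ℚ.+ (x ℚ.+ δ) ≡ x ℚ.+ x ℚ.+ (δ ℚ.+ δ)
      regroup = solve 2 (λ x δ → (x :+ δ) :+ (x :+ δ) := x :+ x :+ (δ :+ δ)) refl
        where open +-*-Solver
      averaged : ∀ δ t →
        (∀ τ ρ → v (mixedRoute r φ ψ) t τ ρ ℚ.≤ seq (b e) t ℚ.+ δ) →
        (∀ τ ρ → v (mixedRoute r ψ φ) t τ ρ ℚ.≤ seq (b e) t ℚ.+ δ) →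
        seq (A e ∙ point φ) t ℚ.+ seq (A e ∙ point ψ) t ℚ.≤ (seq (b e) t ℚ.+ δ) ℚ.+ (seq (b e) t ℚ.+ δ)
      averaged δ t p q = begin
        seq (A e ∙ point φ) t ℚ.+ seq (A e ∙ point ψ) t
          ≡⟨ trans (cong₂ ℚ._+_ (seq-∙ (A e) (point φ) t) (seq-∙ (A e) (point ψ) t))
               (dot-two-points (facAt (A e) t) (pairAt (A e) t) φ ψ r t) ⟩
        average {k} {K} share (λ τ ρ → v (mixedRoute r φ ψ) t τ ρ ℚ.+ v (mixedRoute r ψ φ) t τ ρ)
          ≤⟨ average-mono {k} {K} share (ℚP.<⇒≤ share>0) (λ τ ρ → ℚP.+-mono-≤ (p τ ρ) (q τ ρ)) ⟩
        average {k} {K} share (λ τ ρ → (seq (b e) t ℚ.+ δ) ℚ.+ (seq (b e) t ℚ.+ δ))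
          ≡⟨ average-const {k} {K} share ((seq (b e) t ℚ.+ δ) ℚ.+ (seq (b e) t ℚ.+ δ)) share-unit ⟩
        (seq (b e) t ℚ.+ δ) ℚ.+ (seq (b e) t ℚ.+ δ) ∎
        where open ℚP.≤-Reasoning

    no-common-cut : ∀ φ ψ r → φ r ≢ ψ r → ∀ e →
      ¬ A e ∙ point φ ≤ᵣ b e → ¬ A e ∙ point ψ ≤ᵣ b e → ⊥
    no-common-cut φ ψ r φ≢ψ e = +≤+⇒not-both-≰ (A e ∙ point φ) (A e ∙ point ψ) (b e) (two-points φ ψ r φ≢ψ e)

-- Counting

-- A violated row is found only under a double negation, since the order on reals is not decidable.
-- For finitely many points the double negation can be moved outside.
¬¬-finite-choice : ∀ {N} {Q : Fin N → Set} → (∀ s → ¬ ¬ Q s) → ¬ ¬ (∀ s → Q s)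
¬¬-finite-choice {zero}  h k = k λ ()
¬¬-finite-choice {suc N} h k = h zero λ q → ¬¬-finite-choice (h ∘ suc) λ qs →
  k λ { zero → q ; (suc s) → qs s }

¬∀⇒¬¬∃¬ : ∀ {N} {Q : Fin N → Set} → ¬ (∀ s → Q s) → ¬ ¬ (∃ λ s → ¬ Q s)
¬∀⇒¬¬∃¬ ¬∀ ¬∃ = ¬¬-finite-choice (λ s ¬q → ¬∃ (s , ¬q)) ¬∀

funToFin-cong : ∀ {m n} {f g : Fin m → Fin n} → f ≗ g → funToFin f ≡ funToFin g
funToFin-cong {zero}  f≗g = refl
funToFin-cong {suc m} f≗g = cong₂ Fin.combine (f≗g zero) (funToFin-cong (f≗g ∘ suc))

finToFun-separates : ∀ {k n} (s t : Fin (n ^ k)) → s ≢ t →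
  ∃ λ r → finToFun {n} {k} s r ≢ finToFun t r
finToFun-separates {k} {n} s t s≢t = FinP.¬∀⟶∃¬ k _ (λ r → finToFun s r ≟ finToFun t r) λ eq →
  s≢t (trans (sym (FinP.funToFin-finToFin {k} {n} s))
    (trans (funToFin-cong eq) (FinP.funToFin-finToFin {k} {n} t)))

module _ (a n K₀ B₀ L : ℕ)
  (capacity-eq : suc B₀ ℕ.+ suc K₀ ≡ n ^ 3)
  (facility-eq : suc (L ℕ.+ suc (suc K₀) ℕ.* n) ≡ n ^ 2)
  (remote-eq : suc L ℕ.* n ^ 3 ≡ a ℕ.* n ^ 4)
  (home-fits : suc (suc (suc K₀) ℕ.* n ^ 3) ≤ a ℕ.* n ^ 4)
  where

  open Cuts a n K₀ B₀ L capacity-eq facility-eq remote-eq home-fits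

  number-of-cuts : ∀ {g} → g ≤ᵣ fromℕ K → ∀ {m} {A : Fin m → Vec a n} {b : Fin m → ℝ} →
    ApproximateFormulation g A b → n ^ k ≤ m
  -- The claim is decidable, so it suffices to refute its negation, and for that a violated row may
  -- be picked for every point.
  number-of-cuts {g} g≤K {m} {A} {b} formulation = decidable-stable (n ^ k ≤? m) λ n^k≰m →
    ¬¬-finite-choice (λ s → ¬∀⇒¬¬∃¬ (point∉polyhedron g≤K formulation (choice s))) λ cut →
      let s , t , s<t , same = FinP.pigeonhole (ℕP.≰⇒> n^k≰m) (proj₁ ∘ cut)
          r , differ = finToFun-separates {k} {n} s t (FinP.<⇒≢ s<t)
      in no-common-cut g≤K formulation (choice s) (choice t) r differ (proj₁ (cut s)) (proj₂ (cut s))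
           (subst (λ e → ¬ A e ∙ point (choice t) ≤ᵣ b e) (sym same) (proj₂ (cut t)))
    where
    choice : Fin (n ^ k) → Choice
    choice = finToFun

-- From the number of cuts to the exponential bound

^-cancelʳ-≤ : ∀ x y e .{{_ : ℕ.NonZero e}} → x ^ e ≤ y ^ e → x ≤ y
^-cancelʳ-≤ x y e h = ℕP.≮⇒≥ λ y<x → ℕP.<⇒≱ (ℕP.^-monoˡ-< e y<x) h

-- Here `p / D` stands for a rational exponent below ½ n log₂ n, and `ℓ / suc N` for a lower
-- approximation of log₂ n. Raising to the power `2 * suc N` clears the denominators, so that no
-- roots occur.
exponent-bound : ∀ n k m p D N ℓ .{{_ : ℕ.NonZero n}} → n ≤ 2 ℕ.* k → n ^ k ≤ m → 2 ^ ℓ ≤ n ^ suc N →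
  p ℕ.* (2 ℕ.* suc N) ≤ n ℕ.* ℓ ℕ.* D → 2 ^ p ≤ m ^ D
exponent-bound n k m p D N ℓ n≤2k n^k≤m 2^ℓ≤ h = ℕP.≤-trans
  (^-cancelʳ-≤ (2 ^ p) (n ^ (k ℕ.* D)) (2 ℕ.* suc N) (begin
    (2 ^ p) ^ (2 ℕ.* suc N)        ≡⟨ ℕP.^-*-assoc 2 p (2 ℕ.* suc N) ⟩
    2 ^ (p ℕ.* (2 ℕ.* suc N))      ≤⟨ ℕP.^-monoʳ-≤ 2 h ⟩
    2 ^ (n ℕ.* ℓ ℕ.* D)
      ≡⟨ cong (2 ^_) (solve 3 (λ n ℓ D → n :* ℓ :* D := ℓ :* (n :* D)) refl n ℓ D) ⟩
    2 ^ (ℓ ℕ.* (n ℕ.* D))          ≡⟨ ℕP.^-*-assoc 2 ℓ (n ℕ.* D) ⟨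
    (2 ^ ℓ) ^ (n ℕ.* D)            ≤⟨ ℕP.^-monoˡ-≤ (n ℕ.* D) 2^ℓ≤ ⟩
    (n ^ suc N) ^ (n ℕ.* D)        ≡⟨ ℕP.^-*-assoc n (suc N) (n ℕ.* D) ⟩
    n ^ (suc N ℕ.* (n ℕ.* D))      ≤⟨ ℕP.^-monoʳ-≤ n (ℕP.*-monoʳ-≤ (suc N) (ℕP.*-monoˡ-≤ D n≤2k)) ⟩
    n ^ (suc N ℕ.* (2 ℕ.* k ℕ.* D))
      ≡⟨ cong (n ^_) (solve 3 (λ N k D → N :* (con 2 :* k :* D) := k :* D :* (con 2 :* N)) refl (suc N) k D) ⟩
    n ^ (k ℕ.* D ℕ.* (2 ℕ.* suc N)) ≡⟨ ℕP.^-*-assoc n (k ℕ.* D) (2 ℕ.* suc N) ⟨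
    (n ^ (k ℕ.* D)) ^ (2 ℕ.* suc N) ∎))
  (begin
    n ^ (k ℕ.* D)                  ≡⟨ ℕP.^-*-assoc n k D ⟨
    (n ^ k) ^ D                    ≤⟨ ℕP.^-monoˡ-≤ D n^k≤m ⟩
    m ^ D                          ∎)
  where
  open ℕP.≤-Reasoning
  open ℕ-Solver

half-product-≤ : ∀ r p n ℓ N → ℚ.↥ r ≡ + p → r ℚ.≤ ℚ.½ ℚ.* (natℚ n ℚ.* (+ ℓ ℚ./ suc N)) →
  p ℕ.* (2 ℕ.* suc N) ≤ n ℕ.* ℓ ℕ.* ℚ.↧ₙ r
half-product-≤ r@(mkℚ _ _ _) p n ℓ N ↥r h = ℤP.drop‿+≤+ (subst₂ ℤ._≤_
  (trans (cong (ℤ._* + (2 ℕ.* (1 ℕ.* suc N))) ↥r) (trans (sym (ℤP.pos-* p _)) (cong (λ t → + (p ℕ.* (2 ℕ.* t))) (ℕP.+-identityʳ (suc N)))))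
  (trans (cong (ℤ._* ℚ.↧ r) (trans (ℤP.*-identityˡ _) (sym (ℤP.pos-* n ℓ)))) (sym (ℤP.pos-* (n ℕ.* ℓ) (ℚ.↧ₙ r))))
  (ℚᵘP.drop-*≤* (ℚᵘP.≤-respʳ-≃ product (ℚP.toℚᵘ-mono-≤ {r} {ℚ.½ ℚ.* (natℚ n ℚ.* (+ ℓ ℚ./ suc N))} h))))
  where
  product : toℚᵘ (ℚ.½ ℚ.* (natℚ n ℚ.* (+ ℓ ℚ./ suc N))) ℚᵘ.≃ mkℚᵘ (+ 1) 1 ℚᵘ.* (mkℚᵘ (+ n) 0 ℚᵘ.* mkℚᵘ (+ ℓ) N)
  product = ℚᵘP.≃-trans (ℚP.toℚᵘ-homo-* ℚ.½ (natℚ n ℚ.* (+ ℓ ℚ./ suc N)))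
    (ℚᵘP.*-cong (ℚᵘP.≃-refl {mkℚᵘ (+ 1) 1})
      (ℚᵘP.≃-trans (ℚP.toℚᵘ-homo-* (natℚ n) (+ ℓ ℚ./ suc N))
        (ℚᵘP.*-cong (ℚP.toℚᵘ-fromℚᵘ (mkℚᵘ (+ n) 0)) (ℚP.toℚᵘ-fromℚᵘ (mkℚᵘ (+ ℓ) N)))))

power-bound : ∀ n k m .{{_ : ℕ.NonZero n}} → n ≤ 2 ℕ.* k → n ^ k ≤ m →
  2^ (fromℚ ℚ.½ *ᵣ (fromℕ n *ᵣ log₂ n)) ≤ m
-- A single index `N` suffices, since each term of `log₂ n` is a lower bound for the logarithm.
power-bound n k m n≤2k n^k≤m r@(mkℚ (+ p) d c) (ε , 0<ε , N , h) =
  exponent-bound n k m p (suc d) N (log₂-floor n N) n≤2k n^k≤m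
    (proj₁ (⌊log₂⌋-bounds (n ^ suc N) {{ℕP.m^n≢0 n (suc N)}}))
    (half-product-≤ r p n (log₂-floor n N) N refl (ℚP.≤-trans (≤+pos r 0<ε) (h N ℕP.≤-refl)))
-- A negative exponent asks for no more than `1 ≤ m`.
power-bound n k m n≤2k n^k≤m (mkℚ -[1+ p ] d c) _ =
  ℕP.*-mono-≤ (ℕP.m^n>0 2 (suc p)) (ℕP.m^n>0 m {{ℕ.>-nonZero (ℕP.≤-trans (ℕP.m^n>0 n k) n^k≤m)}} (suc d))

many-constraints : ∀ a K₀ (g : ℝ) → 0 < a → a ≤ suc (suc K₀) → g ≤ᵣ fromℕ (suc K₀) →
  let n = a ℕ.+ suc (suc K₀) in
  (m : ℕ) (A : Fin m → Vec a n) (b : Fin m → ℝ) → ApproximateFormulation g A b →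
  2^ (fromℚ ℚ.½ *ᵣ (fromℕ n *ᵣ log₂ n)) ≤ m
many-constraints a@(suc a′) K₀ g 0<a a≤k g≤K m A b formulation = power-bound n k m
  (ℕP.≤-trans (ℕP.+-monoˡ-≤ k a≤k) (ℕP.≤-reflexive (cong (k ℕ.+_) (sym (ℕP.+-identityʳ k)))))
  (number-of-cuts a n K₀ B₀ L capacity-eq facility-eq remote-eq home-fits g≤K formulation)
  where
  k n B₀ L : ℕ
  k = suc (suc K₀)
  n = a ℕ.+ k
  -- Solves `B + K = U` with `B = suc B₀` and `k = suc K`.
  B₀ = n ^ 3 ℕ.∸ k
  -- The groups use `k * n` of the `n ^ 2` facilities; the other `a * n` are the hub and the remote
  -- ones.
  L = pred (a ℕ.* n)
  open ℕ-Solver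
  k<n : k < n
  k<n = ℕP.m<n+m k (s≤s z≤n)
  capacity-eq : suc B₀ ℕ.+ suc K₀ ≡ n ^ 3
  capacity-eq = trans (sym (ℕP.+-suc B₀ (suc K₀))) (ℕP.m∸n+n≡m (ℕP.≤-trans (ℕP.<⇒≤ k<n)
    (ℕP.≤-trans (ℕP.≤-reflexive (sym (ℕP.^-identityʳ n))) (ℕP.^-monoʳ-≤ n {1} {3} (s≤s z≤n)))))
  suc-L : suc L ≡ a ℕ.* n
  suc-L = ℕP.suc-pred (a ℕ.* n) {{ℕP.m*n≢0 a n}}
  facility-eq : suc (L ℕ.+ k ℕ.* n) ≡ n ^ 2
  facility-eq = trans (cong (ℕ._+ k ℕ.* n) suc-L)
    (trans (sym (ℕP.*-distribʳ-+ n a k)) (cong (n ℕ.*_) (sym (ℕP.*-identityʳ n))))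
  remote-eq : suc L ℕ.* n ^ 3 ≡ a ℕ.* n ^ 4
  remote-eq = trans (cong (ℕ._* n ^ 3) suc-L) (ℕP.*-assoc a n (n ^ 3))
  home-fits : suc (k ℕ.* n ^ 3) ≤ a ℕ.* n ^ 4
  home-fits = ℕP.≤-trans (ℕP.*-monoˡ-< (n ^ 3) {{ℕP.m^n≢0 n 3}} k<n) (ℕP.m≤m+n (n ^ 4) (a′ ℕ.* n ^ 4))

theorem4p1 : (a : ℕ) → 2 ≤ a → (g : ℝ) → 0ᵣ <ᵣ g →
    Σ[ c ∈ ℝ ] 0ᵣ <ᵣ c × Σ[ n₀ ∈ ℕ ] (
    (n : ℕ) → n₀ ≤ n →
    (m : ℕ) (A : Fin m → Vec a n) (b : Fin m → ℝ) →
    ApproximateFormulation g A b →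
    2^ (c *ᵣ (fromℕ n *ᵣ log₂ n)) ≤ m)
theorem4p1 a 2≤a g 0<g =
  let G , g≤G = natural-upper-bound g
  -- The constant is ½ whatever `a` and `g` are; they enter only through the threshold on `n`.
  in fromℚ ℚ.½ , (ℚ.½ , ℚP.positive⁻¹ ℚ.½ , 0 , λ _ _ → ℚP.≤-refl)
   -- From here on a ≤ k, so that n ≤ 2k and nᵏ ≥ 2^(½ n log n), and g ≤ K.
   , a ℕ.+ suc (suc (a ℕ.+ G)) , λ n n₀≤n →
     let d = n ℕ.∸ (a ℕ.+ suc (suc (a ℕ.+ G)))
         K₀ = d ℕ.+ (a ℕ.+ G)
         n≡ : a ℕ.+ suc (suc K₀) ≡ n
         n≡ = trans (solve 3 (λ a G d → a :+ (con 2 :+ (d :+ (a :+ G))) := d :+ (a :+ (con 2 :+ (a :+ G)))) refl a G d)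
                (ℕP.m∸n+n≡m n₀≤n)
         a+G≤K₀ : a ℕ.+ G ≤ K₀
         a+G≤K₀ = ℕP.m≤n+m (a ℕ.+ G) d
     in subst (λ n → (m : ℕ) (A : Fin m → Vec a n) (b : Fin m → ℝ) → ApproximateFormulation g A b →
          2^ (fromℚ ℚ.½ *ᵣ (fromℕ n *ᵣ log₂ n)) ≤ m) n≡
        (many-constraints a K₀ g (ℕP.≤-trans (s≤s z≤n) 2≤a)
          (ℕP.m≤n⇒m≤1+n (ℕP.m≤n⇒m≤1+n (ℕP.≤-trans (ℕP.m≤m+n a G) a+G≤K₀)))
          (≤ᵣ-trans g (fromℕ G) (fromℕ (suc K₀)) g≤G (pointwise-≤ (fromℕ G) (fromℕ (suc K₀))
            (λ _ → natℚ-mono (ℕP.m≤n⇒m≤1+n (ℕP.≤-trans (ℕP.m≤n+m G a) a+G≤K₀))))))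
  where open ℕ-Solver
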